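{- Let $(n_m)_{m\ge0}$ be a monotone increasing sequence of non-negative integers (i.e. $n_m\le n_{m+1}$ for all $m\geq 0$) and, for each prime $q$, let $(\mathbb{F}_q^{n_m},A_m)$ be a uniform random chain complex over $\mathbb{F}_q$ with $m$-th Betti number $\beta_m$. Then for every $m\ge0$, \[ \lim_{q\to\infty}\mathbb{P}[\beta_m=0]=1, \] where the limit is over primes $q$.
   Context: Uniform random chain complex: given a prime $q$ and non-negative integers $(n_m)_{m\ge0}$, it is a random sequence of matrices $A_m$ over $\mathbb{F}_q$ ($m\ge 0$), where $A_m$ has size $n_{m-1}\times n_m$ for $m\geq 1$ and is regarded as a linear map $\mathbb{F}_q^{n_m}\to\mathbb{F}_q^{n_{m-1}}$, and $A_0:\mathbb{F}_q^{n_0}\to 0$ is the zero map. The matrices are chosen successively: for each $m\ge0$, given $A_0,\dots,A_m$, the matrix $A_{m+1}$ is uniformly distributed over all $n_m\times n_{m+1}$ matrices over $\mathbb{F}_q$ satisfying $A_mA_{m+1}=0$ (i.e. entries i.i.d. uniform on $\mathbb{F}_q$, conditioned on $A_mA_{m+1}=0$). Betti number: $\beta_m=\operatorname{nul}(A_m)-\operatorname{rank}(A_{m+1})=\dim_{\mathbb{F}_q}(\ker A_m/\operatorname{im}A_{m+1})$, where $\operatorname{nul}$ denotes the dimension of the kernel. -}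

module Defs where

open import Data.Bool.Base using (if_then_else_)
open import Data.Fin.Base using (Fin; toℕ)
import Data.Fin.Properties as Fin
open import Data.Integer.Base using (ℤ; +_; _⊖_)
open import Data.List.Base as List using (List; []; _∷_; [_])
open import Data.Nat.Base as ℕ using (ℕ; zero; suc; NonZero)
open import Data.Nat.DivMod using (_mod_)
open import Data.Nat.Primality using (Prime; prime⇒nonZero)
open import Data.Product.Base using (∃; ∃-syntax; _×_; _,_; map₁)
open import Data.Rational.Base as ℚ using (ℚ; 0ℚ)
open import Data.Vec.Base as Vec using (Vec; []; _∷_; replicate; transpose; zipWith)
open import Data.Vec.Properties using (≡-dec)
open import Data.Vec.Relation.Unary.All using (All; all?)
open import Function.Base using (_∘_)
open import Relation.Binary.Definitions using (DecidableEquality)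
open import Relation.Binary.PropositionalEquality using (_≡_)
open import Relation.Nullary.Decidable
  using (Dec; does; map′; ¬?; _×-dec_; _→-dec_; decidable-stable)
open import Relation.Unary using (Decidable)

private variable
  A B : Set
  i j k m r s t : ℕ

Searchable : Set → Set₁
Searchable A = {P : A → Set} → Decidable P → Dec (∃ P)

searchVec : Searchable A → ∀ k → Searchable (Vec A k)
searchVec search zero    P? = map′ ([] ,_) (λ { ([] , p) → p }) (P? [])
searchVec search (suc k) P? =
  map′ (λ (x , xs , p) → x ∷ xs , p) (λ { (x ∷ xs , p) → x , xs , p })
       (search λ x → searchVec search k λ xs → P? (x ∷ xs))

forAll? : Searchable A → {P : A → Set} → Decidable P → Dec (∀ x → P x)
forAll? search P? =
  map′ (λ ¬∃ x → decidable-stable (P? x) λ ¬p → ¬∃ (x , ¬p))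
       (λ ∀p (x , ¬p) → ¬p (∀p x))
       (¬? (search (¬? ∘ P?)))

-- The largest k ≤ bound satisfying P, or 0 if there is none.
largest : {P : ℕ → Set} → Decidable P → (bound : ℕ) → ℕ
largest P? zero    = zero
largest P? (suc b) = if does (P? (suc b)) then suc b else largest P? b

-- If xs has no repetitions, then neither does allVecs xs k.
allVecs : List A → ∀ k → List (Vec A k)
allVecs xs zero    = [ [] ]
allVecs xs (suc k) = List.cartesianProductWith _∷_ xs (allVecs xs k)

-- Finitely supported distributions, as lists of weighted outcomes; the
-- probability of an outcome is the total weight of its occurrences.
Dist : Set → Set
Dist A = List (ℚ × A)

-- Uniform on the entries of a list without repetitions.
uniform : List A → Dist A
uniform []            = []
uniform xs@(_ ∷ _) = List.map (λ x → (+ 1 ℚ./ List.length xs) , x) xs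

infixl 1 _>>=_
_>>=_ : Dist A → (A → Dist B) → Dist B
d >>= f = List.concatMap (λ (p , x) → List.map (map₁ (p ℚ.*_)) (f x)) d

mapDist : (A → B) → Dist A → Dist B
mapDist f = List.map (λ (p , x) → p , f x)

ℙ : Dist A → {P : A → Set} → Decidable P → ℚ
ℙ d P? = List.foldr (λ (p , x) acc → if does (P? x) then p ℚ.+ acc else acc) 0ℚ d

-- The field 𝔽_q = ℤ/q is carried by Fin q with arithmetic modulo q.  The
-- operations make sense for every q ≥ 1; they form a field when q is prime.
module Over (q : ℕ) .{{_ : NonZero q}} where

  𝔽 : Set
  𝔽 = Fin q

  0# : 𝔽
  0# = 0 mod q

  infixl 6 _+_
  infixl 7 _*_

  _+_ _*_ : 𝔽 → 𝔽 → 𝔽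
  a + b = (toℕ a ℕ.+ toℕ b) mod q
  a * b = (toℕ a ℕ.* toℕ b) mod q

  Vector : ℕ → Set
  Vector k = Vec 𝔽 k

  -- Matrices are stored as vectors of rows.
  Matrix : ℕ → ℕ → Set
  Matrix rows cols = Vec (Vector cols) rows

  0ᵛ : Vector k
  0ᵛ = replicate _ 0#

  0ᴹ : Matrix r s
  0ᴹ = replicate _ 0ᵛ

  infixl 6 _+ᵛ_
  _+ᵛ_ : Vector k → Vector k → Vector k
  _+ᵛ_ = zipWith _+_

  _*ᵛ_ : 𝔽 → Vector k → Vector k
  a *ᵛ v = Vec.map (a *_) v

  dot : Vector k → Vector k → 𝔽
  dot u v = Vec.foldr′ _+_ 0# (zipWith _*_ u v)

  infixr 7 _·ᵛ_
  _·ᵛ_ : Matrix r s → Vector s → Vector r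
  M ·ᵛ v = Vec.map (λ row → dot row v) M

  infixl 7 _·_
  _·_ : Matrix r s → Matrix s t → Matrix r t
  M · N = Vec.map (λ row → Vec.map (dot row) (transpose N)) M

  _≟ᵛ_ : DecidableEquality (Vector k)
  _≟ᵛ_ = ≡-dec Fin._≟_

  _≟ᴹ_ : DecidableEquality (Matrix r s)
  _≟ᴹ_ = ≡-dec _≟ᵛ_

  searchVector : Searchable (Vector k)
  searchVector = searchVec Fin.any? _

  combination : Vector k → Vec (Vector s) k → Vector s
  combination c vs = Vec.foldr′ _+ᵛ_ 0ᵛ (zipWith _*ᵛ_ c vs)

  LinearlyIndependent : Vec (Vector s) k → Set
  LinearlyIndependent vs = ∀ c → combination c vs ≡ 0ᵛ → c ≡ 0ᵛ

  linearlyIndependent? : Decidable (LinearlyIndependent {s} {k})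
  linearlyIndependent? vs =
    forAll? searchVector λ c → (combination c vs ≟ᵛ 0ᵛ) →-dec (c ≟ᵛ 0ᵛ)

  HasIndependent : (Vector s → Set) → ℕ → Set
  HasIndependent {s} V k = ∃[ vs ] All V {k} vs × LinearlyIndependent {s} vs

  hasIndependent? : {V : Vector s → Set} → Decidable V → Decidable (HasIndependent V)
  hasIndependent? V? k =
    searchVec searchVector k λ vs → all? V? vs ×-dec linearlyIndependent? vs

  -- Dimension of a subspace V of 𝔽ˢ: the maximal number of linearly
  -- independent vectors in V.  No independent family in 𝔽ˢ has more than s
  -- members, and the empty family is always one, so the search is exhaustive.
  dim : {V : Vector s → Set} → Decidable V → ℕ
  dim {s} V? = largest (hasIndependent? V?) s

  Ker : Matrix r s → Vector s → Set
  Ker M v = M ·ᵛ v ≡ 0ᵛ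

  ker? : (M : Matrix r s) → Decidable (Ker M)
  ker? M v = (M ·ᵛ v) ≟ᵛ 0ᵛ

  Im : Matrix r s → Vector r → Set
  Im M v = ∃[ w ] M ·ᵛ w ≡ v

  im? : (M : Matrix r s) → Decidable (Im M)
  im? M v = searchVector λ w → (M ·ᵛ w) ≟ᵛ v

  nul : Matrix r s → ℕ
  nul M = dim (ker? M)

  rank : Matrix r s → ℕ
  rank M = dim (im? M)

  allMatrices : ∀ r s → List (Matrix r s)
  allMatrices r s = allVecs (allVecs (List.allFin q) s) r

  module _ (n : ℕ → ℕ) where

    -- The number of rows of the m-th matrix: A₀ maps to the zero space.
    target : ℕ → ℕ
    target zero    = 0
    target (suc m) = n m

    -- Sequences A₀, …, A_m of matrices of the prescribed sizes.
    Matrices : ℕ → Set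
    Matrices zero    = Matrix 0 (n 0)
    Matrices (suc m) = Matrices m × Matrix (n m) (n (suc m))

    lastMatrix : Matrices m → Matrix (target m) (n m)
    lastMatrix {zero}  A₀      = A₀
    lastMatrix {suc m} (_ , A) = A

    -- The joint law of the initial segment A₀, …, A_m of a uniform random chain
    -- complex: given A₀, …, A_m, the next matrix is uniform among those X with
    -- A_m X = 0.
    randomComplex : ∀ m → Dist (Matrices m)
    randomComplex zero    = uniform [ 0ᴹ ]
    randomComplex (suc m) = randomComplex m >>= λ As →
      mapDist (As ,_)
        (uniform (List.filter (λ X → (lastMatrix As · X) ≟ᴹ 0ᴹ)
                              (allMatrices (n m) (n (suc m)))))

    -- β_m, which depends only on A_m and A_{m+1}.
    betti : ∀ m → Matrices (suc m) → ℤ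
    betti m (As , A) = nul (lastMatrix As) ⊖ rank A

-- f(q) → ℓ as q → ∞ along the primes.  As f and ℓ are rational, it suffices
-- to let ε range over the positive rationals.
LimitOverPrimes : (∀ q → .{{NonZero q}} → ℚ) → ℚ → Set
LimitOverPrimes f ℓ =
  ∀ ε → 0ℚ ℚ.< ε → ∃[ Q ] ∀ q → (q-prime : Prime q) → Q ℕ.≤ q →
    ℚ.∣ f q {{prime⇒nonZero q-prime}} ℚ.- ℓ ∣ ℚ.< ε

{-# OPTIONS --safe #-}

-- Fix A_m = A with kernel V, and let S be the set of matrices X with t ≥ s
-- columns (A having s) and A X = 0.  The total size Σ_X |ker X| over S is
-- computed twice.  Summing over the vectors w first, each w ≠ 0 is killed by
-- at most |S| / |V| of the X, so Σ_X |ker X| ≤ |S| qᵗ / |V| + |S|.  Summing over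
-- X first, |ker X| = qᵗ / |im X| ≥ qᵗ / |V|, and if im X ≠ V then even
-- |ker X| ≥ q · qᵗ / |V|, because im X is then a proper subspace of V.  Hence
-- at most |S| |V| / ((q − 1) qᵗ) ≤ |S| / (q − 1) of the X have im X ≠ V.  This
-- bounds the conditional probability of β_m ≠ 0 given A₀, …, A_m uniformly in
-- the condition.

module Submission where

open import Data.Integer.Base using (0ℤ)
open import Data.Integer.Properties using (_≟_)
open import Data.Nat.Base using (ℕ; suc; _≤_)
open import Data.Rational.Base using (1ℚ)
open import Defs

open import Algebra.Bundles using (CommutativeRing)
open import Algebra.Definitions
import Algebra.Properties.Ring as RingProperties
import Algebra.Properties.Semiring.Sum as SemiringSum
open import Data.Bool.Base using (if_then_else_)
open import Data.Fin.Base as Fin using (Fin; toℕ)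
import Data.Fin.Properties as Fin
open import Data.Integer.Base as ℤ using (_⊖_)
import Data.Integer.Properties as ℤ
import Data.Integer.Solver as ℤ
open import Data.List.Base as List
  using (List; []; _∷_; [_]; _++_; map; length; filter;
         cartesianProduct; cartesianProductWith; allFin)
import Data.List.Properties as List
open import Data.List.Membership.Propositional using (_∈_)
open import Data.List.Membership.Propositional.Properties
  using (∈-∃++; ∈-++⁻; ∈-++⁺ˡ; ∈-++⁺ʳ; ∈-filter⁺; ∈-filter⁻; ∈-allFin;
         ∈-cartesianProduct⁻; ∈-cartesianProductWith⁺)
open import Data.List.Relation.Unary.All as All using (All; []; _∷_)
import Data.List.Relation.Unary.All.Properties as All
open import Data.List.Relation.Unary.AllPairs using ([]; _∷_)
open import Data.List.Relation.Unary.Any using (here; there)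
open import Data.List.Relation.Unary.Unique.Propositional using (Unique)
import Data.List.Relation.Unary.Unique.Propositional.Properties as Unique
open import Data.Nat.Base as ℕ using (zero; NonZero; z≤n; s≤s)
open import Data.Nat.Coprimality using (prime⇒coprime; coprime-Bézout)
open import Data.Nat.DivMod
  using (_%_; _mod_; m%n<n; m<n⇒m%n≡m; n%n≡0; m*n%n≡0; [m+kn]%n≡m%n; %-distribˡ-+; %-distribˡ-*)
open import Data.Nat.GCD using (module Bézout)
open import Data.Nat.ListAction using (sum)
open import Data.Nat.Primality using (Prime; prime⇒nonZero)
import Data.Nat.Properties as ℕ
import Data.Nat.Solver as ℕ
open import Data.Product.Base using (∃-syntax; _×_; _,_; proj₁; proj₂; map₁)
open import Data.Rational.Base as ℚ using (ℚ; mkℚ; 0ℚ; toℚᵘ; fromℚᵘ)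
import Data.Rational.Properties as ℚ
open import Data.Rational.Unnormalised.Base as ℚᵘ using (mkℚᵘ; *≡*; *≤*; *<*)
import Data.Rational.Unnormalised.Properties as ℚᵘ
open import Data.Sum.Base using (_⊎_; inj₁; inj₂)
open import Data.Unit.Base using (tt)
open import Data.Vec.Base as Vec using (Vec; []; _∷_; lookup; transpose; replicate; zipWith)
open import Data.Vec.Properties as Vec using (∷-injective; lookup-map; lookup-replicate; lookup-⊛)
import Data.Vec.Relation.Unary.All as VecAll
open import Function.Base using (_∘_; _$_)
open import Function.Bundles using (_⇔_; mk⇔; module Equivalence)
open import Level using (0ℓ)
open import Relation.Binary.Definitions using (DecidableEquality)
open import Relation.Binary.PropositionalEquality hiding ([_])
open import Relation.Nullary using (¬_; Dec; yes; no; does; contradiction; _×-dec_; ¬?)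
open import Relation.Nullary.Decidable using (decidable-stable; does-⇔)
open import Relation.Unary using (Decidable)

-- The estimate is Markov's inequality for |ker X|. Its floor is qᵗ / |V|, a proper image multiplies
-- the floor by at least q, and the mean exceeds the floor by at most 1, the share of w = 0. Since n
-- is monotone, |V| ≤ qˢ ≤ qᵗ, so the floor is at least 1 and the excess is at most one floor; a
-- deficient X exceeds the floor by at least q - 1 floors, hence the fraction 1 / (q - 1). The
-- argument speaks of cardinalities throughout, because `dim` is an exhaustive search from which
-- bases and rank-nullity would first have to be derived. Kernels and images are compared in size by
-- explicit injections between lists, and every inequality is multiplied by |V| so that it stays in
-- ℕ. `dim` enters only at the end, where `Ker A` and `Im X` have the same members and the two
-- searches return the same number.

private variable
  A B C : Set

-- Linear algebra over 𝔽_q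

lookup-transpose : ∀ {A : Set} {r s} (M : Vec (Vec A s) r) i j →
  lookup (lookup (transpose M) j) i ≡ lookup (lookup M i) j
lookup-transpose {s = s} (row ∷ M) i j = trans (cong (λ v → lookup v i) column) (entry i)
  where
  column : lookup (transpose (row ∷ M)) j ≡ lookup row j ∷ lookup (transpose M) j
  column = trans (lookup-⊛ j (replicate s Vec._∷_ Vec.⊛ row) (transpose M))
    (cong (_$ lookup (transpose M) j)
      (trans (lookup-⊛ j (replicate s Vec._∷_) row)
             (cong (_$ lookup row j) (lookup-replicate j Vec._∷_))))
  entry : ∀ i → lookup (lookup row j ∷ lookup (transpose M) j) i ≡ lookup (lookup (row ∷ M) i) j
  entry Fin.zero    = refl
  entry (Fin.suc i) = lookup-transpose M i j

module LinearAlgebra (q : ℕ) .{{_ : NonZero q}} where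
  open Over q public

  infix 8 -_
  -_ : 𝔽 → 𝔽
  - a = (q ℕ.∸ toℕ a) mod q

  1# : 𝔽
  1# = 1 mod q

  toℕ-mod : ∀ a → toℕ (a mod q) ≡ a % q
  toℕ-mod a = Fin.toℕ-fromℕ< (m%n<n a q)

  mod-cong : ∀ {a b} → a % q ≡ b % q → a mod q ≡ b mod q
  mod-cong {a} {b} eq =
    Fin.toℕ-injective (trans (toℕ-mod a) (trans eq (sym (toℕ-mod b))))

  toℕ-%  : ∀ (a : 𝔽) → toℕ a % q ≡ toℕ a
  toℕ-% a = m<n⇒m%n≡m (Fin.toℕ<n a)

  mod-toℕ : ∀ (a : 𝔽) → toℕ a mod q ≡ a
  mod-toℕ a = Fin.toℕ-injective (trans (toℕ-mod (toℕ a)) (toℕ-% a))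

  -- With `mod-toℕ` this transfers the laws of ℕ: an element c that is not yet visibly a residue is
  -- rewritten as `toℕ c mod q`, and the law is then applied under a single `mod`.
  mod-+ : ∀ a b → a mod q + b mod q ≡ (a ℕ.+ b) mod q
  mod-+ a b = mod-cong (trans (cong₂ (λ x y → (x ℕ.+ y) % q) (toℕ-mod a) (toℕ-mod b))
                              (sym (%-distribˡ-+ a b q)))

  mod-* : ∀ a b → (a mod q) * (b mod q) ≡ (a ℕ.* b) mod q
  mod-* a b = mod-cong (trans (cong₂ (λ x y → (x ℕ.* y) % q) (toℕ-mod a) (toℕ-mod b))
                              (sym (%-distribˡ-* a b q)))

  module _ where
    open ≡-Reasoning

    +-comm : Commutative _≡_ _+_
    +-comm a b = cong (_mod q) (ℕ.+-comm (toℕ a) (toℕ b))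

    *-comm : Commutative _≡_ _*_
    *-comm a b = cong (_mod q) (ℕ.*-comm (toℕ a) (toℕ b))

    +-assoc : Associative _≡_ _+_
    +-assoc a b c = begin
      a + b + c                                ≡⟨ cong (a + b +_) (mod-toℕ c) ⟨
      a + b + toℕ c mod q                      ≡⟨ mod-+ (toℕ a ℕ.+ toℕ b) (toℕ c) ⟩
      (toℕ a ℕ.+ toℕ b ℕ.+ toℕ c) mod q        ≡⟨ cong (_mod q) (ℕ.+-assoc (toℕ a) _ _) ⟩
      (toℕ a ℕ.+ (toℕ b ℕ.+ toℕ c)) mod q      ≡⟨ mod-+ (toℕ a) _ ⟨
      toℕ a mod q + (b + c)                    ≡⟨ cong (_+ (b + c)) (mod-toℕ a) ⟩
      a + (b + c)                              ∎

    *-assoc : Associative _≡_ _*_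
    *-assoc a b c = begin
      a * b * c                                ≡⟨ cong (a * b *_) (mod-toℕ c) ⟨
      a * b * (toℕ c mod q)                    ≡⟨ mod-* (toℕ a ℕ.* toℕ b) (toℕ c) ⟩
      (toℕ a ℕ.* toℕ b ℕ.* toℕ c) mod q        ≡⟨ cong (_mod q) (ℕ.*-assoc (toℕ a) _ _) ⟩
      (toℕ a ℕ.* (toℕ b ℕ.* toℕ c)) mod q      ≡⟨ mod-* (toℕ a) _ ⟨
      (toℕ a mod q) * (b * c)                    ≡⟨ cong (_* (b * c)) (mod-toℕ a) ⟩
      a * (b * c)                              ∎

    *-distribˡ-+ : _DistributesOverˡ_ _≡_ _*_ _+_
    *-distribˡ-+ a b c = begin
      a * (b + c)                                   ≡⟨ cong (_* (b + c)) (mod-toℕ a) ⟨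
      (toℕ a mod q) * (b + c)                         ≡⟨ mod-* (toℕ a) _ ⟩
      (toℕ a ℕ.* (toℕ b ℕ.+ toℕ c)) mod q           ≡⟨ cong (_mod q) (ℕ.*-distribˡ-+ (toℕ a) _ _) ⟩
      (toℕ a ℕ.* toℕ b ℕ.+ toℕ a ℕ.* toℕ c) mod q   ≡⟨ mod-+ (toℕ a ℕ.* toℕ b) _ ⟨
      a * b + a * c                                 ∎

    *-distribʳ-+ : _DistributesOverʳ_ _≡_ _*_ _+_
    *-distribʳ-+ a b c = trans (*-comm (b + c) a)
      (trans (*-distribˡ-+ a b c) (cong₂ _+_ (*-comm a b) (*-comm a c)))

    +-identityˡ : LeftIdentity _≡_ 0# _+_
    +-identityˡ a = begin
      0# + a           ≡⟨ cong (0# +_) (mod-toℕ a) ⟨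
      0# + toℕ a mod q ≡⟨ mod-+ 0 (toℕ a) ⟩
      toℕ a mod q      ≡⟨ mod-toℕ a ⟩
      a                ∎

    *-identityˡ : LeftIdentity _≡_ 1# _*_
    *-identityˡ a = begin
      1# * a                ≡⟨ cong (1# *_) (mod-toℕ a) ⟨
      1# * (toℕ a mod q)      ≡⟨ mod-* 1 (toℕ a) ⟩
      (1 ℕ.* toℕ a) mod q   ≡⟨ cong (_mod q) (ℕ.*-identityˡ (toℕ a)) ⟩
      toℕ a mod q           ≡⟨ mod-toℕ a ⟩
      a                     ∎

    +-inverseˡ : LeftInverse _≡_ 0# -_ _+_
    +-inverseˡ a = begin
      - a + a                        ≡⟨ cong (- a +_) (mod-toℕ a) ⟨
      - a + toℕ a mod q              ≡⟨ mod-+ (q ℕ.∸ toℕ a) (toℕ a) ⟩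
      (q ℕ.∸ toℕ a ℕ.+ toℕ a) mod q  ≡⟨ cong (_mod q) (ℕ.m∸n+n≡m (ℕ.<⇒≤ (Fin.toℕ<n a))) ⟩
      q mod q                        ≡⟨ mod-cong (trans (n%n≡0 q) (sym (m*n%n≡0 0 q))) ⟩
      0#                             ∎

  commutativeRing : CommutativeRing 0ℓ 0ℓ
  commutativeRing = record
    { Carrier = 𝔽 ; _≈_ = _≡_ ; _+_ = _+_ ; _*_ = _*_ ; -_ = -_ ; 0# = 0# ; 1# = 1#
    ; isCommutativeRing = record
      { isRing = record
        { +-isAbelianGroup = record
          { isGroup = record
            { isMonoid = record
              { isSemigroup = record
                { isMagma = record { isEquivalence = isEquivalence ; ∙-cong = cong₂ _+_ }
                ; assoc = +-assoc }
              ; identity = +-identityˡ , λ a → trans (+-comm a 0#) (+-identityˡ a) }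
            ; inverse = +-inverseˡ , λ a → trans (+-comm a (- a)) (+-inverseˡ a)
            ; ⁻¹-cong = cong -_ }
          ; comm = +-comm }
        ; *-cong = cong₂ _*_
        ; *-assoc = *-assoc
        ; *-identity = *-identityˡ , λ a → trans (*-comm a 1#) (*-identityˡ a)
        ; distrib = *-distribˡ-+ , *-distribʳ-+ }
      ; *-comm = *-comm } }

  open CommutativeRing commutativeRing public
    using (semiring; ring; +-identityʳ; -‿inverseʳ; zeroˡ; zeroʳ)
  open SemiringSum semiring public
    using (sum-syntax; sum-cong-≗; ∑-comm; *-distribˡ-sum; *-distribʳ-sum)
  open RingProperties ring public
    using (+-cancelˡ; +-cancelʳ)

  module _ (q-prime : Prime q) where
    open ≡-Reasoning

    -- This is where primality does its work: 0 < a < q makes a coprime to q, and a Bézout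
    -- coefficient of a is an inverse up to sign. Over ℕ the Bézout identity comes in two forms,
    -- according to which side is larger.
    inverse : ∀ a → a ≢ 0# → ∃[ b ] b * a ≡ 1#
    inverse a a≢0 with toℕ a ℕ.≟ 0
    ... | yes eq = contradiction (trans (sym (mod-toℕ a)) (cong (_mod q) eq)) a≢0
    ... | no  ≢0 with coprime-Bézout (prime⇒coprime q-prime {{ℕ.≢-nonZero ≢0}} (Fin.toℕ<n a))
    ... | Bézout.-+ x y 1+xq≡ya = y mod q , (begin
      (y mod q) * a                  ≡⟨ cong ((y mod q) *_) (mod-toℕ a) ⟨
      (y mod q) * (toℕ a mod q)        ≡⟨ mod-* y (toℕ a) ⟩
      (y ℕ.* toℕ a) mod q          ≡⟨ cong (_mod q) 1+xq≡ya ⟨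
      (1 ℕ.+ x ℕ.* q) mod q        ≡⟨ mod-cong ([m+kn]%n≡m%n 1 x q) ⟩
      1#                           ∎)
    -- Here y a = -1 in 𝔽, so -y is the inverse. After y a is added to both sides, each side is 0.
    ... | Bézout.+- x y 1+ya≡xq = - (y mod q) , +-cancelʳ ((y mod q) * a) _ _ (begin
      - (y mod q) * a + (y mod q) * a ≡⟨ *-distribʳ-+ a (- (y mod q)) (y mod q) ⟨
      (- (y mod q) + y mod q) * a   ≡⟨ cong (_* a) (+-inverseˡ (y mod q)) ⟩
      0# * a                        ≡⟨ zeroˡ a ⟩
      0#                            ≡⟨ mod-cong (trans (m*n%n≡0 x q) (sym (m*n%n≡0 0 q))) ⟨
      (x ℕ.* q) mod q               ≡⟨ cong (_mod q) 1+ya≡xq ⟨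
      (1 ℕ.+ y ℕ.* toℕ a) mod q     ≡⟨ mod-+ 1 _ ⟨
      1# + (y ℕ.* toℕ a) mod q      ≡⟨ cong (1# +_) (mod-* y (toℕ a)) ⟨
      1# + (y mod q) * (toℕ a mod q)    ≡⟨ cong (λ h → 1# + (y mod q) * h) (mod-toℕ a) ⟩
      1# + (y mod q) * a              ∎)

  -- Vectors and matrices over 𝔽_q

  private variable
    r s t : ℕ

  +ᵛ-cancelˡ : (u : Vector s) {v w : Vector s} → u +ᵛ v ≡ u +ᵛ w → v ≡ w
  +ᵛ-cancelˡ []      {[]}    {[]}    _  = refl
  +ᵛ-cancelˡ (x ∷ u) {y ∷ v} {z ∷ w} eq with ∷-injective eq
  ... | eq₁ , eq₂ = cong₂ _∷_ (+-cancelˡ x y z eq₁) (+ᵛ-cancelˡ u eq₂)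

  +ᵛ-cancelʳ : (u : Vector s) {v w : Vector s} → v +ᵛ u ≡ w +ᵛ u → v ≡ w
  +ᵛ-cancelʳ []      {[]}    {[]}    _  = refl
  +ᵛ-cancelʳ (x ∷ u) {y ∷ v} {z ∷ w} eq with ∷-injective eq
  ... | eq₁ , eq₂ = cong₂ _∷_ (+-cancelʳ x y z eq₁) (+ᵛ-cancelʳ u eq₂)

  +ᵛ-identityˡ : (u : Vector s) → 0ᵛ +ᵛ u ≡ u
  +ᵛ-identityˡ []      = refl
  +ᵛ-identityˡ (x ∷ u) = cong₂ _∷_ (+-identityˡ x) (+ᵛ-identityˡ u)

  *ᵛ-zeroʳ : ∀ c → c *ᵛ 0ᵛ {s} ≡ 0ᵛ
  *ᵛ-zeroʳ {s} c = trans (Vec.map-replicate (c *_) 0# s) (cong (replicate s) (zeroʳ c))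

  *ᵛ-identityˡ : (u : Vector s) → 1# *ᵛ u ≡ u
  *ᵛ-identityˡ u = trans (Vec.map-cong *-identityˡ u) (Vec.map-id u)

  *ᵛ-assoc : ∀ a b (u : Vector s) → (a * b) *ᵛ u ≡ a *ᵛ (b *ᵛ u)
  *ᵛ-assoc a b u = trans (Vec.map-cong (*-assoc a b) u) (Vec.map-∘ (a *_) (b *_) u)

  infixl 6 _-ᵛ_
  -- Written in the shape `c *ᵛ v +ᵛ w`, so that `·ᵛ-linear` applies to differences as it stands.
  _-ᵛ_ : Vector s → Vector s → Vector s
  u -ᵛ v = (- 1#) *ᵛ v +ᵛ u

  -1*x+x≡0 : ∀ x → - 1# * x + x ≡ 0#
  -1*x+x≡0 x = begin
    - 1# * x + x       ≡⟨ cong (- 1# * x +_) (*-identityˡ x) ⟨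
    - 1# * x + 1# * x  ≡⟨ *-distribʳ-+ x (- 1#) 1# ⟨
    (- 1# + 1#) * x    ≡⟨ cong (_* x) (+-inverseˡ 1#) ⟩
    0# * x             ≡⟨ zeroˡ x ⟩
    0#                 ∎
    where open ≡-Reasoning

  -ᵛ-inverse : (u : Vector s) → u -ᵛ u ≡ 0ᵛ
  -ᵛ-inverse []      = refl
  -ᵛ-inverse (x ∷ u) = cong₂ _∷_ (-1*x+x≡0 x) (-ᵛ-inverse u)

  -- Isolates a multiple of u. When v and w lie in an image and a ≠ b, division by a - b then puts u
  -- in that image.
  +ᵛ-rearrange : ∀ a b (u : Vector s) {v w} →
    a *ᵛ u +ᵛ v ≡ b *ᵛ u +ᵛ w → (a + - b) *ᵛ u ≡ w -ᵛ v
  +ᵛ-rearrange a b []      {[]}    {[]}    _  = refl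
  +ᵛ-rearrange a b (x ∷ u) {y ∷ v} {z ∷ w} eq with ∷-injective eq
  ... | eq₁ , eq₂ = cong₂ _∷_ (+-cancelʳ (b * x + y) _ _ scalar) (+ᵛ-rearrange a b u eq₂)
    where
    open ≡-Reasoning
    scalar : (a + - b) * x + (b * x + y) ≡ - 1# * y + z + (b * x + y)
    scalar = begin
      (a + - b) * x + (b * x + y)   ≡⟨ +-assoc _ _ y ⟨
      (a + - b) * x + b * x + y     ≡⟨ cong (_+ y) (*-distribʳ-+ x _ b) ⟨
      (a + - b + b) * x + y         ≡⟨ cong (λ h → h * x + y) (+-assoc a (- b) b) ⟩
      (a + (- b + b)) * x + y       ≡⟨ cong (λ h → (a + h) * x + y) (+-inverseˡ b) ⟩
      (a + 0#) * x + y              ≡⟨ cong (λ h → h * x + y) (+-identityʳ a) ⟩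
      a * x + y                     ≡⟨ eq₁ ⟩
      b * x + z                     ≡⟨ +-comm (b * x) z ⟩
      z + b * x                     ≡⟨ +-identityˡ _ ⟨
      0# + (z + b * x)              ≡⟨ cong (_+ (z + b * x)) (-1*x+x≡0 y) ⟨
      - 1# * y + y + (z + b * x)    ≡⟨ +-assoc (- 1# * y) y _ ⟩
      - 1# * y + (y + (z + b * x))  ≡⟨ cong (- 1# * y +_) (+-comm y _) ⟩
      - 1# * y + (z + b * x + y)    ≡⟨ cong (- 1# * y +_) (+-assoc z (b * x) y) ⟩
      - 1# * y + (z + (b * x + y))  ≡⟨ +-assoc (- 1# * y) z _ ⟨
      - 1# * y + z + (b * x + y)    ∎

  dot-comm : (u v : Vector s) → dot u v ≡ dot v u
  dot-comm []      []      = refl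
  dot-comm (x ∷ u) (y ∷ v) = cong₂ _+_ (*-comm x y) (dot-comm u v)

  dot-zeroʳ : (u : Vector s) → dot u 0ᵛ ≡ 0#
  dot-zeroʳ []      = refl
  dot-zeroʳ (x ∷ u) = trans (cong₂ _+_ (zeroʳ x) (dot-zeroʳ u)) (+-identityˡ 0#)

  dot-linearʳ : ∀ (u : Vector s) c v w → dot u (c *ᵛ v +ᵛ w) ≡ c * dot u v + dot u w
  dot-linearʳ []      c []      []      = sym (trans (+-identityʳ _) (zeroʳ c))
  dot-linearʳ (x ∷ u) c (y ∷ v) (z ∷ w) = begin
    x * (c * y + z) + dot u (c *ᵛ v +ᵛ w)
      ≡⟨ cong₂ _+_ (*-distribˡ-+ x _ z) (dot-linearʳ u c v w) ⟩
    x * (c * y) + x * z + (c * dot u v + dot u w)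
      ≡⟨ cong (λ h → h + x * z + (c * dot u v + dot u w)) x*cy ⟩
    c * (x * y) + x * z + (c * dot u v + dot u w)
      ≡⟨ +-assoc (c * (x * y)) _ _ ⟩
    c * (x * y) + (x * z + (c * dot u v + dot u w))
      ≡⟨ cong (c * (x * y) +_) swap ⟩
    c * (x * y) + (c * dot u v + (x * z + dot u w))
      ≡⟨ +-assoc (c * (x * y)) _ _ ⟨
    c * (x * y) + c * dot u v + (x * z + dot u w)
      ≡⟨ cong (_+ (x * z + dot u w)) (*-distribˡ-+ c _ _) ⟨
    c * (x * y + dot u v) + (x * z + dot u w) ∎
    where
    open ≡-Reasoning
    x*cy : x * (c * y) ≡ c * (x * y)
    x*cy = trans (sym (*-assoc x c y)) (trans (cong (_* y) (*-comm x c)) (*-assoc c x y))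
    swap : x * z + (c * dot u v + dot u w) ≡ c * dot u v + (x * z + dot u w)
    swap = trans (sym (+-assoc (x * z) _ _))
             (trans (cong (_+ dot u w) (+-comm (x * z) _)) (+-assoc (c * dot u v) _ _))

  dot-sum : (u v : Vector s) → dot u v ≡ ∑[ k < s ] (lookup u k * lookup v k)
  dot-sum []      []      = refl
  dot-sum (x ∷ u) (y ∷ v) = cong (x * y +_) (dot-sum u v)

  ·ᵛ-zeroʳ : (M : Matrix r s) → M ·ᵛ 0ᵛ ≡ 0ᵛ
  ·ᵛ-zeroʳ []        = refl
  ·ᵛ-zeroʳ (row ∷ M) = cong₂ _∷_ (dot-zeroʳ row) (·ᵛ-zeroʳ M)

  ·ᵛ-linear : ∀ (M : Matrix r s) c v w → M ·ᵛ (c *ᵛ v +ᵛ w) ≡ c *ᵛ (M ·ᵛ v) +ᵛ M ·ᵛ w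
  ·ᵛ-linear []        c v w = refl
  ·ᵛ-linear (row ∷ M) c v w = cong₂ _∷_ (dot-linearʳ row c v w) (·ᵛ-linear M c v w)

  ·ᵛ-scale : ∀ (M : Matrix r s) c v → M ·ᵛ (c *ᵛ v) ≡ c *ᵛ (M ·ᵛ v)
  ·ᵛ-scale M c v = +ᵛ-cancelʳ (M ·ᵛ 0ᵛ) (trans (sym (sum-of-scaled)) (·ᵛ-linear M c v 0ᵛ))
    where
    sum-of-scaled : M ·ᵛ (c *ᵛ v +ᵛ 0ᵛ) ≡ M ·ᵛ (c *ᵛ v) +ᵛ M ·ᵛ 0ᵛ
    sum-of-scaled = begin
      M ·ᵛ (c *ᵛ v +ᵛ 0ᵛ)                ≡⟨ cong (λ h → M ·ᵛ (h +ᵛ 0ᵛ)) (*ᵛ-identityˡ (c *ᵛ v)) ⟨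
      M ·ᵛ (1# *ᵛ (c *ᵛ v) +ᵛ 0ᵛ)        ≡⟨ ·ᵛ-linear M 1# (c *ᵛ v) 0ᵛ ⟩
      1# *ᵛ (M ·ᵛ (c *ᵛ v)) +ᵛ M ·ᵛ 0ᵛ   ≡⟨ cong (_+ᵛ M ·ᵛ 0ᵛ) (*ᵛ-identityˡ (M ·ᵛ (c *ᵛ v))) ⟩
      M ·ᵛ (c *ᵛ v) +ᵛ M ·ᵛ 0ᵛ           ∎
      where open ≡-Reasoning

  -- For a row a of A, both sides are the double sum of a_k X_kj w_j, taken in the two orders.
  -- `dot-sum` replaces the recursive `dot` by indexed sums, for which `∑-comm` exchanges the order.
  ·-·ᵛ : (A : Matrix r s) (X : Matrix s t) (w : Vector t) → (A · X) ·ᵛ w ≡ A ·ᵛ (X ·ᵛ w)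
  ·-·ᵛ []                  X w = refl
  ·-·ᵛ {s = s} {t} (a ∷ A) X w = cong₂ _∷_ row (·-·ᵛ A X w)
    where
    open ≡-Reasoning
    column : ∀ j → lookup (Vec.map (dot a) (transpose X)) j
                   ≡ ∑[ k < s ] (lookup a k * lookup (lookup X k) j)
    column j = begin
      lookup (Vec.map (dot a) (transpose X)) j            ≡⟨ lookup-map j (dot a) (transpose X) ⟩
      dot a (lookup (transpose X) j)                      ≡⟨ dot-sum a _ ⟩
      ∑[ k < s ] (lookup a k * lookup (lookup (transpose X) j) k)
        ≡⟨ sum-cong-≗ (λ k → cong (lookup a k *_) (lookup-transpose X k j)) ⟩
      ∑[ k < s ] (lookup a k * lookup (lookup X k) j)     ∎
    entry : ∀ k → lookup (X ·ᵛ w) k ≡ ∑[ j < t ] (lookup (lookup X k) j * lookup w j)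
    entry k = trans (lookup-map k (λ x → dot x w) X) (dot-sum (lookup X k) w)
    row : dot (Vec.map (dot a) (transpose X)) w ≡ dot a (X ·ᵛ w)
    row = begin
      dot (Vec.map (dot a) (transpose X)) w
        ≡⟨ dot-sum (Vec.map (dot a) (transpose X)) w ⟩
      ∑[ j < t ] (lookup (Vec.map (dot a) (transpose X)) j * lookup w j)
        ≡⟨ sum-cong-≗ (λ j → trans (cong (_* lookup w j) (column j))
                (*-distribʳ-sum {s} (lookup w j) (λ k → lookup a k * lookup (lookup X k) j))) ⟩
      ∑[ j < t ] ∑[ k < s ] (lookup a k * lookup (lookup X k) j * lookup w j)
        ≡⟨ ∑-comm (λ j k → lookup a k * lookup (lookup X k) j * lookup w j) ⟩
      ∑[ k < s ] ∑[ j < t ] (lookup a k * lookup (lookup X k) j * lookup w j)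
        ≡⟨ sum-cong-≗ (λ k → trans
             (sum-cong-≗ (λ j → *-assoc (lookup a k) (lookup (lookup X k) j) (lookup w j)))
             (sym (*-distribˡ-sum {t} (lookup a k) (λ j → lookup (lookup X k) j * lookup w j)))) ⟩
      ∑[ k < s ] (lookup a k * ∑[ j < t ] (lookup (lookup X k) j * lookup w j))
        ≡⟨ sum-cong-≗ (λ k → cong (lookup a k *_) (sym (entry k))) ⟩
      ∑[ k < s ] (lookup a k * lookup (X ·ᵛ w) k)
        ≡⟨ dot-sum a (X ·ᵛ w) ⟨
      dot a (X ·ᵛ w) ∎

  -- The witness e is the unit vector at the first nonzero coordinate of w. It detects nonzero rows
  -- in `·ᵛ-null⇒0ᴹ` and gives the direction of the rank-one matrices in `count-killing`.
  dot-nondegenerate : (w : Vector s) → w ≡ 0ᵛ ⊎ ∃[ e ] dot e w ≢ 0#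
  dot-nondegenerate []      = inj₁ refl
  dot-nondegenerate (x ∷ w) with x Fin.≟ 0# | dot-nondegenerate w
  ... | yes x≡0 | inj₁ w≡0 = inj₁ (cong₂ _∷_ x≡0 w≡0)
  ... | yes x≡0 | inj₂ (e , e·w≢0) = inj₂ (0# ∷ e , λ eq →
    e·w≢0 (trans (sym (trans (cong (_+ dot e w) (zeroˡ x)) (+-identityˡ _))) eq))
  ... | no x≢0 | _ = inj₂ (1# ∷ 0ᵛ , λ eq → x≢0 (trans (sym (begin
    1# * x + dot 0ᵛ w ≡⟨ cong₂ _+_ (*-identityˡ x) (trans (dot-comm 0ᵛ w) (dot-zeroʳ w)) ⟩
    x + 0#            ≡⟨ +-identityʳ x ⟩
    x                 ∎)) eq))
    where open ≡-Reasoning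

  ·ᵛ-null⇒0ᴹ : (M : Matrix r s) → (∀ w → M ·ᵛ w ≡ 0ᵛ) → M ≡ 0ᴹ
  ·ᵛ-null⇒0ᴹ []        null = refl
  ·ᵛ-null⇒0ᴹ (row ∷ M) null = cong₂ _∷_ row≡0 (·ᵛ-null⇒0ᴹ M (proj₂ ∘ ∷-injective ∘ null))
    where
    row≡0 : row ≡ 0ᵛ
    row≡0 with dot-nondegenerate row
    ... | inj₁ row≡0       = row≡0
    ... | inj₂ (e , e·row≢0) =
      contradiction (trans (dot-comm e row) (proj₁ (∷-injective (null e)))) e·row≢0

  0ᴹ-·ᵛ : (w : Vector s) → 0ᴹ {r} ·ᵛ w ≡ 0ᵛ
  0ᴹ-·ᵛ {r = zero}  w = refl
  0ᴹ-·ᵛ {r = suc r} w = cong₂ _∷_ (trans (dot-comm 0ᵛ w) (dot-zeroʳ w)) (0ᴹ-·ᵛ w)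

  ·≡0⇒im⊆ker : {A : Matrix r s} {X : Matrix s t} → A · X ≡ 0ᴹ → ∀ w → A ·ᵛ (X ·ᵛ w) ≡ 0ᵛ
  ·≡0⇒im⊆ker {A = A} {X} AX≡0 w =
    trans (sym (·-·ᵛ A X w)) (trans (cong (_·ᵛ w) AX≡0) (0ᴹ-·ᵛ w))

  -- A matrix is determined by its action on vectors. Together with `·≡0⇒im⊆ker` this turns the
  -- conditioning A X = 0 into im X ⊆ ker A, a form that visibly survives adding v eᵀ with v in ker
  -- A.
  im⊆ker⇒·≡0 : {A : Matrix r s} {X : Matrix s t} → (∀ w → A ·ᵛ (X ·ᵛ w) ≡ 0ᵛ) → A · X ≡ 0ᴹ
  im⊆ker⇒·≡0 {A = A} {X} im⊆ker = ·ᵛ-null⇒0ᴹ _ λ w → trans (·-·ᵛ A X w) (im⊆ker w)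

  -- The rank-one update X + v eᵀ.
  addOuter : Matrix s t → Vector s → Vector t → Matrix s t
  addOuter X v e = zipWith (λ x c → x +ᵛ c *ᵛ e) X v

  addOuter-·ᵛ : ∀ (X : Matrix s t) v e w → addOuter X v e ·ᵛ w ≡ dot e w *ᵛ v +ᵛ X ·ᵛ w
  addOuter-·ᵛ []      []      e w = refl
  addOuter-·ᵛ (x ∷ X) (c ∷ v) e w = cong₂ _∷_ row (addOuter-·ᵛ X v e w)
    where
    open ≡-Reasoning
    +ᵛ-comm : (u v : Vector t) → u +ᵛ v ≡ v +ᵛ u
    +ᵛ-comm u v = Vec.zipWith-comm +-comm u v
    row : dot (x +ᵛ c *ᵛ e) w ≡ dot e w * c + dot x w
    row = begin
      dot (x +ᵛ c *ᵛ e) w        ≡⟨ dot-comm _ w ⟩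
      dot w (x +ᵛ c *ᵛ e)        ≡⟨ cong (dot w) (+ᵛ-comm x _) ⟩
      dot w (c *ᵛ e +ᵛ x)        ≡⟨ dot-linearʳ w c e x ⟩
      c * dot w e + dot w x      ≡⟨ cong₂ (λ g h → c * g + h) (dot-comm w e) (dot-comm w x) ⟩
      c * dot e w + dot x w      ≡⟨ cong (_+ dot x w) (*-comm c _) ⟩
      dot e w * c + dot x w      ∎

  addOuter-cancel : ∀ {X Y : Matrix s t} v e → addOuter X v e ≡ addOuter Y v e → X ≡ Y
  addOuter-cancel {X = []}    {[]}    []      e _  = refl
  addOuter-cancel {X = x ∷ X} {y ∷ Y} (c ∷ v) e eq with ∷-injective eq
  ... | eq₁ , eq₂ = cong₂ _∷_ (+ᵛ-cancelʳ (c *ᵛ e) eq₁) (addOuter-cancel v e eq₂)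

-- Counting in finite lists

open import Data.Nat.Base using (_+_; _*_)

-- Induction on `xs`: one occurrence of `f x` is cut out of `ys`, and injectivity keeps the images
-- of the other entries in what remains. Injectivity is asked only on members, since the shift in
-- `count-killing` is recovered only from X that kill w.
length-injection : ∀ {xs : List A} {ys : List B} (f : A → B) → Unique xs →
  (∀ {x} → x ∈ xs → f x ∈ ys) →
  (∀ {x y} → x ∈ xs → y ∈ xs → f x ≡ f y → x ≡ y) → length xs ≤ length ys
length-injection {xs = []}     f _            f∈ inj = z≤n
length-injection {xs = x ∷ xs} f (x∉xs ∷ xs!) f∈ inj with ∈-∃++ (f∈ (here refl))
... | as , bs , refl = begin
  suc (length xs)                 ≤⟨ s≤s (length-injection f xs! f∈′ λ y∈ z∈ → inj (there y∈) (there z∈)) ⟩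
  suc (length (as ++ bs))         ≡⟨ cong suc (List.length-++ as) ⟩
  suc (length as + length bs)     ≡⟨ ℕ.+-suc (length as) (length bs) ⟨
  length as + suc (length bs)     ≡⟨ List.length-++ as ⟨
  length (as ++ f x ∷ bs)         ∎
  where
  open ℕ.≤-Reasoning
  f∈′ : ∀ {y} → y ∈ xs → f y ∈ as ++ bs
  f∈′ {y} y∈xs with ∈-++⁻ as (f∈ (there y∈xs))
  ... | inj₁ fy∈as            = ∈-++⁺ˡ fy∈as
  ... | inj₂ (there fy∈bs)    = ∈-++⁺ʳ as fy∈bs
  ... | inj₂ (here fy≡fx)     =
    contradiction (inj (here refl) (there y∈xs) (sym fy≡fx)) (All.lookup x∉xs y∈xs)

indicator : Dec A → ℕ
indicator A? = if does A? then 1 else 0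

count : {P : A → Set} → Decidable P → List A → ℕ
count P? xs = length (filter P? xs)

count-∷ : ∀ {P : A → Set} (P? : Decidable P) x xs → count P? (x ∷ xs) ≡ indicator (P? x) + count P? xs
count-∷ P? x xs with P? x
... | yes _ = refl
... | no  _ = refl

sumOver : (A → ℕ) → List A → ℕ
sumOver f xs = sum (map f xs)

sumOver-mono : ∀ {f g : A → ℕ} xs → (∀ {x} → x ∈ xs → f x ≤ g x) → sumOver f xs ≤ sumOver g xs
sumOver-mono []       f≤g = z≤n
sumOver-mono (x ∷ xs) f≤g = ℕ.+-mono-≤ (f≤g (here refl)) (sumOver-mono xs (f≤g ∘ there))

sumOver-*ʳ : ∀ (f : A → ℕ) c xs → sumOver (λ x → f x * c) xs ≡ sumOver f xs * c
sumOver-*ʳ f c []       = refl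
sumOver-*ʳ f c (x ∷ xs) = trans (cong (f x * c +_) (sumOver-*ʳ f c xs))
                                (sym (ℕ.*-distribʳ-+ c (f x) (sumOver f xs)))

-- Sums a bound that has two cases. It is applied to the X, with a surplus for the deficient ones,
-- and to the w, with a surplus for w = 0.
sumOver-affine : ∀ {P : A → Set} (P? : Decidable P) a b xs →
  sumOver (λ x → a + indicator (P? x) * b) xs ≡ length xs * a + count P? xs * b
sumOver-affine P? a b []       = refl
sumOver-affine P? a b (x ∷ xs)
  rewrite count-∷ P? x xs | sumOver-affine P? a b xs =
  solve 5 (λ a b i l c → a :+ i :* b :+ (l :* a :+ c :* b) := a :+ l :* a :+ (i :+ c) :* b) refl
    a b (indicator (P? x)) (length xs) (count P? xs)
  where open ℕ.+-*-Solver

-- Double counting of the related pairs: an entry x added to `xs` raises the count of each y by one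
-- `indicator`.
sumOver-count-swap : ∀ {R : A → B → Set} (R? : ∀ x y → Dec (R x y)) xs ys →
  sumOver (λ x → count (R? x) ys) xs ≡ sumOver (λ y → count (λ x → R? x y) xs) ys
sumOver-count-swap {A = A} {B} R? []       ys = sym (zeros ys)
  where
  zeros : (ys : List B) → sumOver (λ _ → 0) ys ≡ 0
  zeros []       = refl
  zeros (_ ∷ ys) = zeros ys
sumOver-count-swap {A = A} {B} R? (x ∷ xs) ys =
  trans (cong (count (R? x) ys +_) (sumOver-count-swap R? xs ys)) (split ys)
  where
  open ℕ.+-*-Solver
  split : ∀ ys → count (R? x) ys + sumOver (λ y → count (λ z → R? z y) xs) ys
               ≡ sumOver (λ y → count (λ z → R? z y) (x ∷ xs)) ys
  split []       = refl
  split (y ∷ ys) rewrite count-∷ (R? x) y ys | count-∷ (λ z → R? z y) x xs | sym (split ys) =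
    solve 4 (λ i m n o → i :+ m :+ (n :+ o) := i :+ n :+ (m :+ o)) refl
      (indicator (R? x y)) (count (R? x) ys) (count (λ z → R? z y) xs) _

-- Counts the pairs (x, y) with f x = y: each x occurs in at least one of them, each y in at most k.
length-fibres : ∀ (_≟_ : DecidableEquality B) (f : A → B) k xs ys → (∀ {x} → x ∈ xs → f x ∈ ys) →
  (∀ y → count (λ x → f x ≟ y) xs ≤ k) → length xs ≤ k * length ys
length-fibres _≟_ f k xs ys f∈ fibre≤k = begin
  length xs                                          ≡⟨ sumOver-1 xs ⟨
  sumOver (λ _ → 1) xs
    ≤⟨ sumOver-mono xs (λ x∈ → List.filter-some (f _ ≟_) (f∈ x∈)) ⟩
  sumOver (λ x → count (f x ≟_) ys) xs               ≡⟨ sumOver-count-swap (λ x y → f x ≟ y) xs ys ⟩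
  sumOver (λ y → count (λ x → f x ≟ y) xs) ys        ≤⟨ sumOver-mono ys (λ {y} _ → fibre≤k y) ⟩
  sumOver (λ _ → k) ys                               ≡⟨ sumOver-const ys ⟩
  k * length ys                                      ∎
  where
  open ℕ.≤-Reasoning
  sumOver-const : ∀ ys → sumOver (λ _ → k) ys ≡ k * length ys
  sumOver-const []       = sym (ℕ.*-zeroʳ k)
  sumOver-const (_ ∷ ys) = trans (cong (k +_) (sumOver-const ys)) (sym (ℕ.*-suc k _))
  sumOver-1 : ∀ xs → sumOver (λ _ → 1) xs ≡ length xs
  sumOver-1 []       = refl
  sumOver-1 (_ ∷ xs) = cong suc (sumOver-1 xs)

-- h x₀ sends the fibre of f through x₀ injectively into zs.
length-fibred : ∀ (_≟_ : DecidableEquality B) (f : A → B) (h : A → A → C) {xs ys zs} → Unique xs →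
  (∀ x → f x ∈ ys) →
  (∀ {x₀ x} → f x ≡ f x₀ → h x₀ x ∈ zs) →
  (∀ {x₀ x y} → f x ≡ f x₀ → f y ≡ f x₀ → h x₀ x ≡ h x₀ y → x ≡ y) →
  length xs ≤ length zs * length ys
length-fibred _≟_ f h {xs} {ys} {zs} xs! f∈ys h∈zs h-inj =
  length-fibres _≟_ f (length zs) xs ys (λ {x} _ → f∈ys x) fibre
  where
  fibre : ∀ y → count (λ x → f x ≟ y) xs ≤ length zs
  fibre y = bound _ (Unique.filter⁺ (λ x → f x ≟ y) xs!)
    λ x∈ → proj₂ (∈-filter⁻ (λ x → f x ≟ y) {xs = xs} x∈)
    where
    bound : ∀ ws → Unique ws → (∀ {x} → x ∈ ws → f x ≡ y) → length ws ≤ length zs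
    -- A nonempty fibre takes its first member as base point; an empty one has none and is trivially
    -- small.
    bound []            _   _  = z≤n
    bound ws@(x₀ ∷ _) ws! f≡ =
      length-injection (h x₀) ws! (h∈zs ∘ f≡f) λ x∈ y∈ → h-inj (f≡f x∈) (f≡f y∈)
      where
      f≡f : ∀ {x} → x ∈ ws → f x ≡ f x₀
      f≡f x∈ = trans (f≡ x∈) (sym (f≡ (here refl)))

length-cartesianProductWith : ∀ (f : A → B → C) xs ys →
  length (cartesianProductWith f xs ys) ≡ length xs * length ys
length-cartesianProductWith f []       ys = refl
length-cartesianProductWith f (x ∷ xs) ys =
  trans (List.length-++ (map (f x) ys))
        (cong₂ _+_ (List.length-map (f x) ys) (length-cartesianProductWith f xs ys))

length-allVecs : ∀ (xs : List A) k → length (allVecs xs k) ≡ length xs ℕ.^ k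
length-allVecs xs zero    = refl
length-allVecs xs (suc k) = trans (length-cartesianProductWith _∷_ xs (allVecs xs k))
                                  (cong (length xs *_) (length-allVecs xs k))

∈-allVecs : ∀ {xs : List A} → (∀ x → x ∈ xs) → ∀ {k} (v : Vec A k) → v ∈ allVecs xs k
∈-allVecs x∈xs []      = here refl
∈-allVecs x∈xs (x ∷ v) = ∈-cartesianProductWith⁺ _∷_ (x∈xs x) (∈-allVecs x∈xs v)

allVecs-unique : ∀ {xs : List A} → Unique xs → ∀ k → Unique (allVecs xs k)
allVecs-unique xs! zero    = [] ∷ []
allVecs-unique xs! (suc k) = Unique.cartesianProductWith⁺ _∷_ ∷-injective xs! (allVecs-unique xs! k)

-- Matrices whose image is not the whole kernel

module Counting (q : ℕ) .{{_ : NonZero q}} where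
  open LinearAlgebra q hiding (_+_; _*_)
  open LinearAlgebra q using () renaming (_+_ to _+𝔽_; _*_ to _*𝔽_)

  private variable
    r s t : ℕ

  allVectors : ∀ s → List (Vector s)
  allVectors = allVecs (allFin q)

  ∈-allVectors : (v : Vector s) → v ∈ allVectors s
  ∈-allVectors = ∈-allVecs ∈-allFin

  allVectors-unique : ∀ s → Unique (allVectors s)
  allVectors-unique = allVecs-unique (Unique.allFin⁺ q)

  length-allVectors : ∀ s → length (allVectors s) ≡ q ℕ.^ s
  length-allVectors s = trans (length-allVecs (allFin q) s)
    (cong (ℕ._^ s) (List.length-tabulate {n = q} _))

  annihilated? : (A : Matrix r s) → Decidable (λ (X : Matrix s t) → A · X ≡ 0ᴹ)
  annihilated? A X = (A · X) ≟ᴹ 0ᴹ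

  annihilated : Matrix r s → ∀ t → List (Matrix s t)
  annihilated {s = s} A t = filter (annihilated? A) (allMatrices s t)

  ∈-annihilated : ∀ {A : Matrix r s} {X : Matrix s t} → A · X ≡ 0ᴹ → X ∈ annihilated A t
  ∈-annihilated {A = A} {X} = ∈-filter⁺ (annihilated? A) (∈-allVecs ∈-allVectors X)

  ∈-annihilated⁻ : ∀ (A : Matrix r s) {X : Matrix s t} → X ∈ annihilated A t → A · X ≡ 0ᴹ
  ∈-annihilated⁻ {s = s} {t} A X∈ = proj₂ (∈-filter⁻ (annihilated? A) {xs = allMatrices s t} X∈)

  annihilated-unique : ∀ (A : Matrix r s) t → Unique (annihilated A t)
  annihilated-unique {s = s} A t =
    Unique.filter⁺ (annihilated? A) (allVecs-unique (allVectors-unique t) s)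

  kernel : Matrix r s → List (Vector s)
  kernel M = filter (ker? M) (allVectors _)

  ∈-kernel : ∀ (M : Matrix r s) {v} → Ker M v → v ∈ kernel M
  ∈-kernel M {v} = ∈-filter⁺ (ker? M) (∈-allVectors v)

  ∈-kernel⁻ : ∀ (M : Matrix r s) {v} → v ∈ kernel M → Ker M v
  ∈-kernel⁻ {s = s} M v∈ = proj₂ (∈-filter⁻ (ker? M) {xs = allVectors s} v∈)

  -- When A X = 0, this says that im X is a proper subspace of ker A. The missing vector v is kept
  -- as data because its multiples label the cosets counted in `length-kernel`.
  Deficient : Matrix r s → Matrix s t → Set
  Deficient A X = ∃[ v ] Ker A v × ¬ Im X v

  deficient? : (A : Matrix r s) → Decidable (Deficient {t = t} A)
  deficient? A X = searchVector λ v → ker? A v ×-dec ¬? (im? X v)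

  Ker-combination : ∀ (M : Matrix r s) c {v w} → Ker M v → Ker M w → Ker M (c *ᵛ v +ᵛ w)
  Ker-combination M c {v} {w} Mv≡0 Mw≡0 = begin
    M ·ᵛ (c *ᵛ v +ᵛ w)        ≡⟨ ·ᵛ-linear M c v w ⟩
    c *ᵛ (M ·ᵛ v) +ᵛ M ·ᵛ w   ≡⟨ cong₂ (λ g h → c *ᵛ g +ᵛ h) Mv≡0 Mw≡0 ⟩
    c *ᵛ 0ᵛ +ᵛ 0ᵛ             ≡⟨ cong (_+ᵛ 0ᵛ) (*ᵛ-zeroʳ c) ⟩
    0ᵛ +ᵛ 0ᵛ                  ≡⟨ +ᵛ-identityˡ 0ᵛ ⟩
    0ᵛ                        ∎
    where open ≡-Reasoning

  module _ (q-prime : Prime q) where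

    *ᵛ-cancelˡ : ∀ {c} {u v : Vector s} → c ≢ 0# → c *ᵛ u ≡ c *ᵛ v → u ≡ v
    *ᵛ-cancelˡ {c = c} {u} {v} c≢0 eq with inverse q-prime c c≢0
    ... | d , dc≡1 = trans (sym (unscale u)) (trans (cong (d *ᵛ_) eq) (unscale v))
      where
      unscale : ∀ u → d *ᵛ (c *ᵛ u) ≡ u
      unscale u = trans (sym (*ᵛ-assoc d c u)) (trans (cong (_*ᵛ u) dc≡1) (*ᵛ-identityˡ u))

    -- Adding rank-one matrices v ⊗ e with e · w ≠ 0 to the X that kill w is injective.
    count-killing : ∀ (A : Matrix r s) (w : Vector t) →
      count (λ X → (X ·ᵛ w) ≟ᵛ 0ᵛ) (annihilated A t) * length (kernel A)
        ≤ length (annihilated A t) +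
          indicator (w ≟ᵛ 0ᵛ) * (length (annihilated A t) * length (kernel A))
    count-killing {t = t} A w with w ≟ᵛ 0ᵛ
    -- For w = 0 the trivial bound |S| |V| is taken; the summand `length S`, common to both cases,
    -- gives the affine shape that `sumOver-affine` sums.
    ... | yes _ = begin
      count (λ X → (X ·ᵛ w) ≟ᵛ 0ᵛ) S * K  ≤⟨ ℕ.*-monoˡ-≤ K (List.length-filter _ S) ⟩
      length S * K                        ≡⟨ ℕ.*-identityˡ _ ⟨
      1 * (length S * K)                  ≤⟨ ℕ.m≤n+m _ (length S) ⟩
      length S + 1 * (length S * K)       ∎
      where
      open ℕ.≤-Reasoning
      S = annihilated A t
      K = length (kernel A)
    ... | no w≢0 with dot-nondegenerate w
    ... | inj₁ w≡0          = contradiction w≡0 w≢0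
    ... | inj₂ (e , e·w≢0) = begin
      length Z * length (kernel A)           ≡⟨ length-cartesianProductWith _,_ Z (kernel A) ⟨
      length (cartesianProduct Z (kernel A)) ≤⟨ length-injection shift unique shift∈S shift-inj ⟩
      length S                               ≡⟨ ℕ.+-identityʳ _ ⟨
      length S + 0                           ∎
      where
      open ℕ.≤-Reasoning
      S = annihilated A t
      kills? = λ (X : Matrix _ t) → (X ·ᵛ w) ≟ᵛ 0ᵛ
      Z = filter kills? S
      unique : Unique (cartesianProduct Z (kernel A))
      unique = Unique.cartesianProduct⁺ (Unique.filter⁺ kills? (annihilated-unique A t))
                                        (Unique.filter⁺ (ker? A) (allVectors-unique _))
      shift : Matrix _ t × Vector _ → Matrix _ t
      shift (X , v) = addOuter X v e
      shift∈S : ∀ {p} → p ∈ cartesianProduct Z (kernel A) → shift p ∈ S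
      shift∈S {X , v} p∈ with ∈-cartesianProduct⁻ Z (kernel A) p∈
      ... | X∈Z , v∈K with ∈-filter⁻ kills? {xs = S} X∈Z
      ... | X∈S , _ = ∈-annihilated {A = A} (im⊆ker⇒·≡0 λ u →
        subst (Ker A) (sym (addOuter-·ᵛ X v e u))
          (Ker-combination A (dot e u) (∈-kernel⁻ A v∈K)
                             (·≡0⇒im⊆ker {A = A} (∈-annihilated⁻ A X∈S) u)))
      shift-·ᵛ : ∀ {X v} → (X , v) ∈ cartesianProduct Z (kernel A) →
        shift (X , v) ·ᵛ w ≡ dot e w *ᵛ v +ᵛ 0ᵛ
      shift-·ᵛ {X} {v} p∈ = trans (addOuter-·ᵛ X v e w) (cong (dot e w *ᵛ v +ᵛ_)
        (proj₂ (∈-filter⁻ kills? {xs = S} (proj₁ (∈-cartesianProduct⁻ Z (kernel A) p∈)))))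
      shift-inj : ∀ {p p′} → p ∈ cartesianProduct Z (kernel A) → p′ ∈ cartesianProduct Z (kernel A) →
        shift p ≡ shift p′ → p ≡ p′
      -- Since X and X′ kill w, the shifted matrices send w to (e · w) v and (e · w) v′. As e · w ≠
      -- 0, this recovers v, and then X.
      shift-inj {X , v} {X′ , v′} p∈ p′∈ eq
        with *ᵛ-cancelˡ {u = v} {v = v′} e·w≢0 (+ᵛ-cancelʳ 0ᵛ
               (trans (sym (shift-·ᵛ p∈)) (trans (cong (_·ᵛ w) eq) (shift-·ᵛ p′∈))))
      ... | refl = cong (_, v) (addOuter-cancel v e eq)

    Ker-difference : ∀ (M : Matrix r s) {v w} → M ·ᵛ v ≡ M ·ᵛ w → Ker M (v -ᵛ w)
    Ker-difference M {v} {w} eq = trans (·ᵛ-linear M (- 1#) w v)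
      (trans (cong (M ·ᵛ v -ᵛ_) (sym eq)) (-ᵛ-inverse (M ·ᵛ v)))

    -- If c ≠ c′, then (c - c′) v = X (u′ - u), and division by c - c′ exhibits a preimage of v.
    -- Thus the q cosets c v + im X are pairwise disjoint, which is the source of the factor q.
    coefficient-unique : ∀ (X : Matrix s t) {v} → ¬ Im X v → ∀ {c c′ u u′} →
      c *ᵛ v +ᵛ X ·ᵛ u ≡ c′ *ᵛ v +ᵛ X ·ᵛ u′ → c ≡ c′
    coefficient-unique X {v} v∉im {c} {c′} {u} {u′} eq with (c +𝔽 - c′) Fin.≟ 0#
    ... | yes c-c′≡0 = +-cancelʳ (- c′) c c′ (trans c-c′≡0 (sym (-‿inverseʳ c′)))
    ... | no c-c′≢0 with inverse q-prime (c +𝔽 - c′) c-c′≢0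
    ... | d , d*≡1 = contradiction (d *ᵛ (u′ -ᵛ u) , preimage) v∉im
      where
      open ≡-Reasoning
      preimage : X ·ᵛ (d *ᵛ (u′ -ᵛ u)) ≡ v
      preimage = begin
        X ·ᵛ (d *ᵛ (u′ -ᵛ u))       ≡⟨ ·ᵛ-scale X d (u′ -ᵛ u) ⟩
        d *ᵛ (X ·ᵛ (u′ -ᵛ u))       ≡⟨ cong (d *ᵛ_) (·ᵛ-linear X (- 1#) u u′) ⟩
        d *ᵛ (X ·ᵛ u′ -ᵛ X ·ᵛ u)    ≡⟨ cong (d *ᵛ_) (+ᵛ-rearrange c c′ v eq) ⟨
        d *ᵛ ((c +𝔽 - c′) *ᵛ v)     ≡⟨ *ᵛ-assoc d _ v ⟨
        (d *𝔽 (c +𝔽 - c′)) *ᵛ v     ≡⟨ cong (_*ᵛ v) d*≡1 ⟩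
        1# *ᵛ v                     ≡⟨ *ᵛ-identityˡ v ⟩
        v                           ∎

    -- The fibres of u ↦ X u have at most |ker X| members, and the values lie in ker A. If v in ker
    -- A is missed by X, the domain is enlarged to pairs (c, w) with value c v + X w: the value
    -- determines c and X w, so the fibres do not grow while the domain becomes q times larger. The
    -- surplus q - 1 is split off to fit `sumOver-affine`.
    length-kernel : ∀ (A : Matrix r s) {X : Matrix s t} → X ∈ annihilated A t →
      length (allVectors t) + indicator (deficient? A X) * ((q ℕ.∸ 1) * length (allVectors t))
        ≤ length (kernel X) * length (kernel A)
    length-kernel {t = t} A {X} X∈S with deficient? A X
    ... | no _ = begin
      length (allVectors t) + 0 ≡⟨ ℕ.+-identityʳ _ ⟩
      length (allVectors t)     ≤⟨ length-fibred _≟ᵛ_ (X ·ᵛ_) (λ u v → v -ᵛ u) (allVectors-unique t)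
                                     (λ v → ∈-kernel A (·≡0⇒im⊆ker {A = A} (∈-annihilated⁻ A X∈S) v))
                                     (λ eq → ∈-kernel X (Ker-difference X eq))
                                     (λ {u} _ _ → +ᵛ-cancelˡ ((- 1#) *ᵛ u)) ⟩
      length (kernel X) * length (kernel A) ∎
      where open ℕ.≤-Reasoning
    ... | yes (v , Av≡0 , v∉im) = begin
      N + 1 * ((q ℕ.∸ 1) * N)                     ≡⟨ cong (N +_) (ℕ.*-identityˡ _) ⟩
      (1 + (q ℕ.∸ 1)) * N                         ≡⟨ cong (_* N) (ℕ.m+[n∸m]≡n (ℕ.>-nonZero⁻¹ q)) ⟩
      q * N                                       ≡⟨ cong (_* N) (List.length-tabulate {n = q} _) ⟨
      length (allFin q) * N
        ≡⟨ length-cartesianProductWith _,_ (allFin q) (allVectors t) ⟨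
      length (cartesianProduct (allFin q) (allVectors t))
        ≤⟨ length-fibred _≟ᵛ_ f (λ (_ , u) (_ , w) → w -ᵛ u)
             (Unique.cartesianProduct⁺ (Unique.allFin⁺ q) (allVectors-unique t))
             f∈
             (λ {p₀} {p} eq → ∈-kernel X (Ker-difference X (proj₂ (f-inj p p₀ eq))))
             (λ {p₀@(_ , u)} {p} {p′} eq eq′ diff≡ →
               cong₂ _,_ (trans (proj₁ (f-inj p p₀ eq)) (sym (proj₁ (f-inj p′ p₀ eq′))))
                         (+ᵛ-cancelˡ ((- 1#) *ᵛ u) diff≡)) ⟩
      length (kernel X) * length (kernel A)       ∎
      where
      open ℕ.≤-Reasoning
      N = length (allVectors t)
      f : 𝔽 × Vector t → Vector _
      f (c , w) = c *ᵛ v +ᵛ X ·ᵛ w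
      f∈ : ∀ p → f p ∈ kernel A
      f∈ (c , w) = ∈-kernel A
        (Ker-combination A c Av≡0 (·≡0⇒im⊆ker {A = A} (∈-annihilated⁻ A X∈S) w))
      f-inj : ∀ p p′ → f p ≡ f p′ → proj₁ p ≡ proj₁ p′ × X ·ᵛ proj₂ p ≡ X ·ᵛ proj₂ p′
      f-inj (c , u) (c′ , u′) eq with coefficient-unique X v∉im {c} {c′} {u} {u′} eq
      ... | refl = refl , +ᵛ-cancelˡ (c *ᵛ v) eq

    -- Both evaluations of the total, multiplied by K = |ker A|, contain |S| N with N = qᵗ.
    -- Cancelling it leaves the surplus of the deficient X against the surplus |S| K of w = 0.
    few-deficient : ∀ (A : Matrix r s) → s ≤ t →
      count (deficient? A) (annihilated A t) * (q ℕ.∸ 1) ≤ length (annihilated A t)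
    few-deficient {r} {s} {t} A s≤t =
      ℕ.*-cancelʳ-≤ _ _ N {{N≢0}} (ℕ.+-cancelˡ-≤ (length S * N) _ _ (begin
        length S * N + bad * (q ℕ.∸ 1) * N
          ≡⟨ cong (length S * N +_) (ℕ.*-assoc bad (q ℕ.∸ 1) N) ⟩
        length S * N + bad * ((q ℕ.∸ 1) * N)
          ≡⟨ sumOver-affine (deficient? A) N ((q ℕ.∸ 1) * N) S ⟨
        sumOver (λ X → N + indicator (deficient? A X) * ((q ℕ.∸ 1) * N)) S
          ≤⟨ sumOver-mono S (length-kernel A) ⟩
        sumOver (λ X → length (kernel X) * K) S
          ≡⟨ sumOver-*ʳ (λ X → length (kernel X)) K S ⟩
        sumOver (λ X → length (kernel X)) S * K
          ≡⟨ cong (_* K) (sumOver-count-swap ker? S W) ⟩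
        sumOver (λ w → count (λ X → ker? X w) S) W * K
          ≡⟨ sumOver-*ʳ (λ w → count (λ X → ker? X w) S) K W ⟨
        sumOver (λ w → count (λ X → ker? X w) S * K) W
          ≤⟨ sumOver-mono W (λ {w} _ → count-killing A w) ⟩
        sumOver (λ w → length S + indicator (w ≟ᵛ 0ᵛ) * (length S * K)) W
          ≡⟨ sumOver-affine (_≟ᵛ 0ᵛ) (length S) (length S * K) W ⟩
        N * length S + count (_≟ᵛ 0ᵛ) W * (length S * K)
          ≤⟨ ℕ.+-mono-≤ (ℕ.≤-reflexive (ℕ.*-comm N (length S)))
                          (ℕ.*-mono-≤ zeros≤1 (ℕ.*-monoʳ-≤ (length S) K≤N)) ⟩
        length S * N + 1 * (length S * N)
          ≡⟨ cong (length S * N +_) (ℕ.*-identityˡ _) ⟩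
        length S * N + length S * N ∎))
      where
      open ℕ.≤-Reasoning
      S = annihilated A t
      W = allVectors t
      N = length W
      K = length (kernel A)
      bad = count (deficient? A) S
      zeros≤1 : count (_≟ᵛ 0ᵛ) W ≤ 1
      zeros≤1 = length-injection {ys = [ 0ᵛ ]} (λ w → w)
        (Unique.filter⁺ (_≟ᵛ 0ᵛ) (allVectors-unique t))
        (λ w∈ → here (proj₂ (∈-filter⁻ (_≟ᵛ 0ᵛ) {xs = W} w∈))) (λ _ _ eq → eq)
      K≤N : K ≤ N
      -- Monotonicity of the dimensions acts here: ker A lies in 𝔽ˢ, and s ≤ t makes the surplus |S|
      -- K at most |S| N, so that N cancels.
      K≤N = begin
        K                      ≤⟨ List.length-filter (ker? A) (allVectors s) ⟩
        length (allVectors s)  ≡⟨ length-allVectors s ⟩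
        q ℕ.^ s                ≤⟨ ℕ.^-monoʳ-≤ q s≤t ⟩
        q ℕ.^ t                ≡⟨ length-allVectors t ⟨
        N                      ∎
      N≢0 : NonZero N
      N≢0 = subst NonZero (sym (length-allVectors t)) (ℕ.m^n≢0 q t)

-- Finitely supported distributions

-- For d = suc d-1 the fraction n / d is by definition `fromℚᵘ (mkℚᵘ n d-1)`. Fractions are
-- therefore added and compared unnormalised, by cross-multiplication, and the result is carried
-- back.
fromℚᵘ-homo-+ : ∀ p q → fromℚᵘ p ℚ.+ fromℚᵘ q ≡ fromℚᵘ (p ℚᵘ.+ q)
fromℚᵘ-homo-+ p q = ℚ.toℚᵘ-injective (begin-equality
  toℚᵘ (fromℚᵘ p ℚ.+ fromℚᵘ q)           ≃⟨ ℚ.toℚᵘ-homo-+ (fromℚᵘ p) (fromℚᵘ q) ⟩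
  toℚᵘ (fromℚᵘ p) ℚᵘ.+ toℚᵘ (fromℚᵘ q)   ≃⟨ ℚᵘ.+-cong (ℚ.toℚᵘ-fromℚᵘ p) (ℚ.toℚᵘ-fromℚᵘ q) ⟩
  p ℚᵘ.+ q                               ≃⟨ ℚ.toℚᵘ-fromℚᵘ (p ℚᵘ.+ q) ⟨
  toℚᵘ (fromℚᵘ (p ℚᵘ.+ q))               ∎)
  where open ℚᵘ.≤-Reasoning

fromℚᵘ-mono-≤ : ∀ {p q} → p ℚᵘ.≤ q → fromℚᵘ p ℚ.≤ fromℚᵘ q
fromℚᵘ-mono-≤ {p} {q} p≤q = ℚ.toℚᵘ-cancel-≤ (begin
  toℚᵘ (fromℚᵘ p) ≃⟨ ℚ.toℚᵘ-fromℚᵘ p ⟩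
  p               ≤⟨ p≤q ⟩
  q               ≃⟨ ℚ.toℚᵘ-fromℚᵘ q ⟨
  toℚᵘ (fromℚᵘ q) ∎)
  where open ℚᵘ.≤-Reasoning

/-homo-+ : ∀ a b d .{{_ : NonZero d}} → (ℤ.+ a ℚ./ d) ℚ.+ (ℤ.+ b ℚ./ d) ≡ ℤ.+ (a ℕ.+ b) ℚ./ d
/-homo-+ a b d@(suc d-1) = trans (fromℚᵘ-homo-+ (mkℚᵘ (ℤ.+ a) d-1) (mkℚᵘ (ℤ.+ b) d-1))
  (ℚ.fromℚᵘ-cong {mkℚᵘ (ℤ.+ a) d-1 ℚᵘ.+ mkℚᵘ (ℤ.+ b) d-1} {mkℚᵘ (ℤ.+ (a ℕ.+ b)) d-1} (*≡*
    (trans (solve 3 (λ a b d → (a :* d :+ b :* d) :* d := (a :+ b) :* (d :* d)) refl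
             (ℤ.+ a) (ℤ.+ b) (ℤ.+ d))
           (cong₂ ℤ._*_ (sym (ℤ.pos-+ a b)) (sym (ℤ.pos-* d d))))))
  where open ℤ.+-*-Solver

/-mono-≤ : ∀ a b c d .{{_ : NonZero b}} .{{_ : NonZero d}} →
  a ℕ.* d ≤ c ℕ.* b → ℤ.+ a ℚ./ b ℚ.≤ ℤ.+ c ℚ./ d
/-mono-≤ a (suc b-1) c (suc d-1) ad≤cb = fromℚᵘ-mono-≤ {mkℚᵘ (ℤ.+ a) b-1} {mkℚᵘ (ℤ.+ c) d-1}
  (*≤* (subst₂ ℤ._≤_ (ℤ.pos-* a _) (ℤ.pos-* c _) (ℤ.+≤+ ad≤cb)))

n/n≡1 : ∀ n .{{_ : NonZero n}} → ℤ.+ n ℚ./ n ≡ 1ℚ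
n/n≡1 n@(suc n-1) =
  ℚ.fromℚᵘ-cong {mkℚᵘ (ℤ.+ n) n-1} {mkℚᵘ (ℤ.+ 1) 0} (*≡* (ℤ.*-comm (ℤ.+ n) (ℤ.+ 1)))

0/n≡0 : ∀ n .{{_ : NonZero n}} → ℤ.+ 0 ℚ./ n ≡ 0ℚ
0/n≡0 (suc n-1) = ℚ.fromℚᵘ-cong {mkℚᵘ (ℤ.+ 0) n-1} {mkℚᵘ (ℤ.+ 0) 0} (*≡* refl)

-- A positive ε has the form (n + 1) / d, and 1 / (d + 1) < 1 / d ≤ ε. As d is `suc d-1`, the bound
-- carries two `suc`.
reciprocal-below : ∀ ε → 0ℚ ℚ.< ε → ℤ.+ 1 ℚ./ suc (suc (ℚ.denominator-1 ε)) ℚ.< ε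
reciprocal-below (mkℚ (ℤ.+ zero)      d-1 _) (ℚ.*<* (ℤ.+<+ ()))
reciprocal-below (mkℚ ℤ.+[1+ n ]    d-1 _) _ = ℚ.toℚᵘ-cancel-< (begin-strict
  toℚᵘ (fromℚᵘ (mkℚᵘ (ℤ.+ 1) (suc d-1)))  ≃⟨ ℚ.toℚᵘ-fromℚᵘ (mkℚᵘ (ℤ.+ 1) (suc d-1)) ⟩
  mkℚᵘ (ℤ.+ 1) (suc d-1)
    <⟨ *<* (ℤ.+<+ (ℕ.<-≤-trans (ℕ.*-monoʳ-< 1 (ℕ.n<1+n (suc d-1)))
                               (ℕ.*-monoˡ-≤ (suc (suc d-1)) (s≤s (z≤n {n}))))) ⟩
  mkℚᵘ ℤ.+[1+ n ] d-1                   ∎)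
  where open ℚᵘ.≤-Reasoning
reciprocal-below (mkℚ (ℤ.-[1+ n ]) d-1 _) (ℚ.*<* ())

length≤count+count : ∀ {P Q : A → Set} (P? : Decidable P) (Q? : Decidable Q) xs →
  (∀ {x} → x ∈ xs → P x ⊎ Q x) → length xs ≤ count P? xs ℕ.+ count Q? xs
length≤count+count P? Q? []       P⊎Q = z≤n
length≤count+count P? Q? (x ∷ xs) P⊎Q
  with ih ← length≤count+count P? Q? xs (P⊎Q ∘ there) | P? x | Q? x
... | yes _ | yes _ = s≤s (ℕ.≤-trans ih (ℕ.+-monoʳ-≤ (count P? xs) (ℕ.n≤1+n _)))
... | yes _ | no  _ = s≤s ih
... | no  _ | yes _ = ℕ.≤-trans (s≤s ih) (ℕ.≤-reflexive (sym (ℕ.+-suc (count P? xs) _)))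
... | no ¬p | no ¬q with P⊎Q (here refl)
...   | inj₁ p = contradiction p ¬p
...   | inj₂ q = contradiction q ¬q

-- Mixtures and the uniform law

mass : Dist A → ℚ
mass d = ℙ d (λ _ → yes tt)

NonNegative : Dist A → Set
NonNegative = All (λ (p , _) → 0ℚ ℚ.≤ p)

ℙ-++ : ∀ {P : A → Set} (P? : Decidable P) d e → ℙ (d ++ e) P? ≡ ℙ d P? ℚ.+ ℙ e P?
ℙ-++ P? []            e = sym (ℚ.+-identityˡ _)
ℙ-++ P? ((p , x) ∷ d) e with P? x
... | yes _ = trans (cong (p ℚ.+_) (ℙ-++ P? d e)) (sym (ℚ.+-assoc p _ _))
... | no  _ = ℙ-++ P? d e

ℙ-scale : ∀ {P : A → Set} (P? : Decidable P) p d → ℙ (map (map₁ (p ℚ.*_)) d) P? ≡ p ℚ.* ℙ d P?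
ℙ-scale P? p []            = sym (ℚ.*-zeroʳ p)
ℙ-scale P? p ((r , x) ∷ d) with P? x
... | yes _ = trans (cong (p ℚ.* r ℚ.+_) (ℙ-scale P? p d)) (sym (ℚ.*-distribˡ-+ p r _))
... | no  _ = ℙ-scale P? p d

ℙ-mapDist : ∀ {P : B → Set} (P? : Decidable P) (f : A → B) d → ℙ (mapDist f d) P? ≡ ℙ d (P? ∘ f)
ℙ-mapDist P? f []            = refl
ℙ-mapDist P? f ((p , x) ∷ d) with P? (f x)
... | yes _ = cong (p ℚ.+_) (ℙ-mapDist P? f d)
... | no  _ = ℙ-mapDist P? f d

ℙ->>= : ∀ {P : B → Set} (P? : Decidable P) p x d (f : A → Dist B) →
  ℙ (((p , x) ∷ d) >>= f) P? ≡ p ℚ.* ℙ (f x) P? ℚ.+ ℙ (d >>= f) P?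
ℙ->>= P? p x d f = trans (ℙ-++ P? (map (map₁ (p ℚ.*_)) (f x)) (d >>= f))
                         (cong (ℚ._+ ℙ (d >>= f) P?) (ℙ-scale P? p (f x)))

-- A bound on the conditional probabilities, uniform in the condition, passes to the mixture. The
-- factor `mass d` makes the induction possible: the tail of a distribution no longer has mass 1.
ℙ->>=-lower : ∀ {P : B → Set} (P? : Decidable P) {d : Dist A} {f : A → Dist B} {a} → NonNegative d →
  (∀ x → a ℚ.≤ ℙ (f x) P?) → mass d ℚ.* a ℚ.≤ ℙ (d >>= f) P?
ℙ->>=-lower P? {[]}          {f} {a} []          a≤ = ℚ.≤-reflexive (ℚ.*-zeroˡ a)
ℙ->>=-lower P? {(p , x) ∷ d} {f} {a} (0≤p ∷ 0≤d) a≤ = begin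
  (p ℚ.+ mass d) ℚ.* a                   ≡⟨ ℚ.*-distribʳ-+ a p (mass d) ⟩
  p ℚ.* a ℚ.+ mass d ℚ.* a
    ≤⟨ ℚ.+-mono-≤ (ℚ.*-monoˡ-≤-nonNeg p {{ℚ.nonNegative 0≤p}} (a≤ x))
                  (ℙ->>=-lower P? {d} {f} 0≤d a≤) ⟩
  p ℚ.* ℙ (f x) P? ℚ.+ ℙ (d >>= f) P?    ≡⟨ ℙ->>= P? p x d f ⟨
  ℙ (((p , x) ∷ d) >>= f) P?             ∎
  where open ℚ.≤-Reasoning

ℙ->>=-upper : ∀ {P : B → Set} (P? : Decidable P) {d : Dist A} {f : A → Dist B} {b} → NonNegative d →
  (∀ x → ℙ (f x) P? ℚ.≤ b) → ℙ (d >>= f) P? ℚ.≤ mass d ℚ.* b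
ℙ->>=-upper P? {[]}          {f} {b} []          ≤b = ℚ.≤-reflexive (sym (ℚ.*-zeroˡ b))
ℙ->>=-upper P? {(p , x) ∷ d} {f} {b} (0≤p ∷ 0≤d) ≤b = begin
  ℙ (((p , x) ∷ d) >>= f) P?             ≡⟨ ℙ->>= P? p x d f ⟩
  p ℚ.* ℙ (f x) P? ℚ.+ ℙ (d >>= f) P?
    ≤⟨ ℚ.+-mono-≤ (ℚ.*-monoˡ-≤-nonNeg p {{ℚ.nonNegative 0≤p}} (≤b x))
                  (ℙ->>=-upper P? {d} {f} 0≤d ≤b) ⟩
  p ℚ.* b ℚ.+ mass d ℚ.* b               ≡⟨ ℚ.*-distribʳ-+ b p (mass d) ⟨
  (p ℚ.+ mass d) ℚ.* b                   ∎
  where open ℚ.≤-Reasoning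

-- The bounds from below and above for the sure event, both with constant 1, pin the mass down.
mass->>= : ∀ {d : Dist A} {f : A → Dist B} → NonNegative d → (∀ x → mass (f x) ≡ 1ℚ) →
  mass (d >>= f) ≡ mass d
mass->>= {d = d} {f} 0≤d mass≡1 = trans (ℚ.≤-antisym
  (ℙ->>=-upper (λ _ → yes tt) {d} {f} 0≤d (ℚ.≤-reflexive ∘ mass≡1))
  (ℙ->>=-lower (λ _ → yes tt) {d} {f} 0≤d (ℚ.≤-reflexive ∘ sym ∘ mass≡1)))
  (ℚ.*-identityʳ _)

nonNegative->>= : ∀ {d : Dist A} {f : A → Dist B} → NonNegative d → (∀ x → NonNegative (f x)) →
  NonNegative (d >>= f)
nonNegative->>= {d = []}          {f} []          0≤f = []
nonNegative->>= {d = (p , x) ∷ d} {f} (0≤p ∷ 0≤d) 0≤f = All.++⁺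
  (All.map⁺ (All.map (λ {(r , _)} 0≤r → subst (ℚ._≤ p ℚ.* r) (ℚ.*-zeroʳ p)
                                           (ℚ.*-monoˡ-≤-nonNeg p {{ℚ.nonNegative 0≤p}} 0≤r)) (0≤f x)))
  (nonNegative->>= 0≤d 0≤f)

ℙ-uniform : ∀ {P : A → Set} (P? : Decidable P) xs .{{_ : NonZero (length xs)}} →
  ℙ (uniform xs) P? ≡ ℤ.+ count P? xs ℚ./ length xs
ℙ-uniform P? xs@(x₀ ∷ xs₀) = weigh xs
  where
  -- The weight stays 1 / length xs while the list shrinks, hence the separate `ys`.
  weigh : ∀ ys → ℙ (map (λ x → (ℤ.+ 1 ℚ./ length xs) , x) ys) P? ≡ ℤ.+ count P? ys ℚ./ length xs
  weigh []       = sym (0/n≡0 (length xs))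
  weigh (y ∷ ys) with P? y
  ... | yes _ = trans (cong ((ℤ.+ 1 ℚ./ length xs) ℚ.+_) (weigh ys))
                      (/-homo-+ 1 (count P? ys) (length xs))
  ... | no  _ = weigh ys

nonNegative-uniform : ∀ (xs : List A) → NonNegative (uniform xs)
nonNegative-uniform []            = []
nonNegative-uniform xs@(x₀ ∷ xs₀) = All.map⁺ (All.universal (λ _ → 0≤1/n) xs)
  where
  0≤1/n : 0ℚ ℚ.≤ ℤ.+ 1 ℚ./ length xs
  0≤1/n = subst (ℚ._≤ ℤ.+ 1 ℚ./ length xs) (0/n≡0 (length xs))
    (/-mono-≤ 0 (length xs) 1 (length xs) z≤n)

mass-uniform : ∀ (xs : List A) .{{_ : NonZero (length xs)}} → mass (uniform xs) ≡ 1ℚ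
mass-uniform xs = trans (ℙ-uniform (λ _ → yes tt) xs)
  (trans (cong (λ l → ℤ.+ l ℚ./ length xs)
               (cong length (List.filter-all (λ _ → yes tt) (All.universal _ xs))))
         (n/n≡1 (length xs)))

ℙ-uniform≤1 : ∀ {P : A → Set} (P? : Decidable P) xs .{{_ : NonZero (length xs)}} →
  ℙ (uniform xs) P? ℚ.≤ 1ℚ
ℙ-uniform≤1 P? xs = begin
  ℙ (uniform xs) P?              ≡⟨ ℙ-uniform P? xs ⟩
  ℤ.+ count P? xs ℚ./ length xs    ≤⟨ /-mono-≤ (count P? xs) (length xs) (length xs) (length xs)
                                     (ℕ.*-monoˡ-≤ (length xs) (List.length-filter P? xs)) ⟩
  ℤ.+ length xs ℚ./ length xs      ≡⟨ n/n≡1 (length xs) ⟩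
  1ℚ                             ∎
  where open ℚ.≤-Reasoning

p≤q+r⇒p-r≤q : ∀ {p q r} → p ℚ.≤ q ℚ.+ r → p ℚ.- r ℚ.≤ q
p≤q+r⇒p-r≤q {p} {q} {r} p≤q+r = begin
  p ℚ.- r              ≤⟨ ℚ.+-monoˡ-≤ (ℚ.- r) p≤q+r ⟩
  q ℚ.+ r ℚ.- r        ≡⟨ ℚ.+-assoc q r (ℚ.- r) ⟩
  q ℚ.+ (r ℚ.- r)      ≡⟨ cong (q ℚ.+_) (ℚ.+-inverseʳ r) ⟩
  q ℚ.+ 0ℚ             ≡⟨ ℚ.+-identityʳ q ⟩
  q                    ∎
  where open ℚ.≤-Reasoning

-- Q covers the failures of P, so the shares of P and Q add up to at least 1, and the last
-- hypothesis says, without denominators, that the share of Q is at most 1 / k.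
ℙ-uniform-lower : ∀ {P Q : A → Set} (P? : Decidable P) (Q? : Decidable Q) xs
  .{{_ : NonZero (length xs)}} k .{{_ : NonZero k}} →
  (∀ {x} → x ∈ xs → P x ⊎ Q x) → count Q? xs ℕ.* k ≤ length xs →
  1ℚ ℚ.- (ℤ.+ 1 ℚ./ k) ℚ.≤ ℙ (uniform xs) P?
ℙ-uniform-lower P? Q? xs k P⊎Q few = p≤q+r⇒p-r≤q (begin
  1ℚ
    ≡⟨ n/n≡1 l ⟨
  ℤ.+ l ℚ./ l
    ≤⟨ /-mono-≤ l l (count P? xs ℕ.+ count Q? xs) l
         (ℕ.*-monoˡ-≤ l (length≤count+count P? Q? xs P⊎Q)) ⟩
  ℤ.+ (count P? xs ℕ.+ count Q? xs) ℚ./ l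
    ≡⟨ /-homo-+ (count P? xs) (count Q? xs) l ⟨
  (ℤ.+ count P? xs ℚ./ l) ℚ.+ (ℤ.+ count Q? xs ℚ./ l)
    ≡⟨ cong (ℚ._+ (ℤ.+ count Q? xs ℚ./ l)) (ℙ-uniform P? xs) ⟨
  ℙ (uniform xs) P? ℚ.+ (ℤ.+ count Q? xs ℚ./ l)
    ≤⟨ ℚ.+-monoʳ-≤ (ℙ (uniform xs) P?)
         (/-mono-≤ (count Q? xs) l 1 k
           (subst (count Q? xs ℕ.* k ≤_) (sym (ℕ.*-identityˡ l)) few)) ⟩
  ℙ (uniform xs) P? ℚ.+ (ℤ.+ 1 ℚ./ k) ∎)
  where
  open ℚ.≤-Reasoning
  l = length xs

∣p-1∣≤ : ∀ {p δ} → 1ℚ ℚ.- δ ℚ.≤ p → p ℚ.≤ 1ℚ → ℚ.∣ p ℚ.- 1ℚ ∣ ℚ.≤ δ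
∣p-1∣≤ {p} {δ} 1-δ≤p p≤1 = begin
  ℚ.∣ p ℚ.- 1ℚ ∣            ≡⟨ ℚ.∣-p∣≡∣p∣ (p ℚ.- 1ℚ) ⟨
  ℚ.∣ ℚ.- (p ℚ.- 1ℚ) ∣      ≡⟨ cong ℚ.∣_∣ (trans (ℚ.neg-distrib-+ p (ℚ.- 1ℚ))
                                                  (ℚ.+-comm (ℚ.- p) 1ℚ)) ⟩
  ℚ.∣ 1ℚ ℚ.- p ∣            ≡⟨ ℚ.0≤p⇒∣p∣≡p 0≤1-p ⟩
  1ℚ ℚ.- p                  ≤⟨ p≤q+r⇒p-r≤q 1≤δ+p ⟩
  δ                         ∎
  where
  open ℚ.≤-Reasoning
  0≤1-p : 0ℚ ℚ.≤ 1ℚ ℚ.- p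
  0≤1-p = subst (ℚ._≤ 1ℚ ℚ.- p) (ℚ.+-inverseʳ p) (ℚ.+-monoˡ-≤ (ℚ.- p) p≤1)
  1≤δ+p : 1ℚ ℚ.≤ δ ℚ.+ p
  1≤δ+p = begin
    1ℚ                      ≡⟨ ℚ.+-identityʳ 1ℚ ⟨
    1ℚ ℚ.+ 0ℚ               ≡⟨ cong (1ℚ ℚ.+_) (ℚ.+-inverseˡ δ) ⟨
    1ℚ ℚ.+ (ℚ.- δ ℚ.+ δ)    ≡⟨ ℚ.+-assoc 1ℚ (ℚ.- δ) δ ⟨
    1ℚ ℚ.- δ ℚ.+ δ          ≤⟨ ℚ.+-monoˡ-≤ δ 1-δ≤p ⟩
    p ℚ.+ δ                 ≡⟨ ℚ.+-comm p δ ⟩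
    δ ℚ.+ p                 ∎

-- Random chain complexes

largest-cong : ∀ {P Q : ℕ → Set} (P? : Decidable P) (Q? : Decidable Q) →
  (∀ k → P k ⇔ Q k) → ∀ b → largest P? b ≡ largest Q? b
largest-cong P? Q? P⇔Q zero    = refl
largest-cong P? Q? P⇔Q (suc b)
  rewrite does-⇔ (P⇔Q (suc b)) (P? (suc b)) (Q? (suc b)) | largest-cong P? Q? P⇔Q b = refl

module ChainComplex (q : ℕ) .{{_ : NonZero q}} where
  open LinearAlgebra q using (·≡0⇒im⊆ker; im⊆ker⇒·≡0; 0ᴹ-·ᵛ; ·ᵛ-zeroʳ)
  open Counting q
  open Over q

  dim-cong : ∀ {s} {V W : Vector s → Set} (V? : Decidable V) (W? : Decidable W) →
    (∀ v → V v ⇔ W v) → dim V? ≡ dim W?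
  dim-cong {s} V? W? V⇔W = largest-cong (hasIndependent? V?) (hasIndependent? W?) (λ k → mk⇔
    (λ (vs , Vvs , ind) → vs , VecAll.map (Equivalence.to (V⇔W _)) Vvs , ind)
    (λ (vs , Wvs , ind) → vs , VecAll.map (Equivalence.from (V⇔W _)) Wvs , ind)) s

  nul≡rank : ∀ {r s t} (A : Matrix r s) (X : Matrix s t) → A · X ≡ 0ᴹ → ¬ Deficient A X →
    nul A ≡ rank X
  nul≡rank A X AX≡0 ¬deficient = dim-cong (ker? A) (im? X) λ v → mk⇔
    -- That X is not deficient yields a preimage of v only up to double negation, which the finite
    -- search behind `im?` removes.
    (λ Av≡0 → decidable-stable (im? X v) λ v∉im → ¬deficient (v , Av≡0 , v∉im))
    (λ { (w , refl) → ·≡0⇒im⊆ker {A = A} AX≡0 w })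

  -- The zero matrix is always admissible. This keeps the total mass at 1, since `uniform []` has
  -- mass 0.
  annihilated-nonEmpty : ∀ {r s} (A : Matrix r s) t → NonZero (length (annihilated A t))
  annihilated-nonEmpty {s = s} A t = inhabited (∈-annihilated {A = A} {0ᴹ} (im⊆ker⇒·≡0 {A = A} λ w →
      trans (cong (A ·ᵛ_) (0ᴹ-·ᵛ {r = s} w)) (·ᵛ-zeroʳ A)))
    where
    inhabited : ∀ {X : Matrix s t} {Xs} → X ∈ Xs → NonZero (length Xs)
    inhabited (here _)  = _
    inhabited (there _) = _

  module _ (n : ℕ → ℕ) where

    next : ∀ m → Matrices n m → List (Matrix (n m) (n (suc m)))
    next m As = annihilated (lastMatrix n As) (n (suc m))

    -- Chosen so that `randomComplex n (suc m)` computes to `randomComplex n m >>= extend m`, to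
    -- which the mixture bounds apply.
    extend : ∀ m → Matrices n m → Dist (Matrices n (suc m))
    extend m As = mapDist (As ,_) (uniform (next m As))

    mass-extend : ∀ m As → mass (extend m As) ≡ 1ℚ
    mass-extend m As = trans (ℙ-mapDist (λ _ → yes tt) (As ,_) (uniform (next m As)))
      (mass-uniform (next m As) {{annihilated-nonEmpty (lastMatrix n As) (n (suc m))}})

    nonNegative-randomComplex : ∀ m → NonNegative (randomComplex n m)
    nonNegative-randomComplex zero    = nonNegative-uniform [ 0ᴹ ]
    nonNegative-randomComplex (suc m) =
      nonNegative->>= {d = randomComplex n m} {f = extend m} (nonNegative-randomComplex m)
        λ As → All.map⁺ (nonNegative-uniform (next m As))

    mass-randomComplex : ∀ m → mass (randomComplex n m) ≡ 1ℚ
    mass-randomComplex zero    = mass-uniform [ 0ᴹ {0} {n 0} ]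
    mass-randomComplex (suc m) =
      trans (mass->>= {d = randomComplex n m} {f = extend m}
                       (nonNegative-randomComplex m) (mass-extend m))
            (mass-randomComplex m)

    ℙ-betti≡0 : Prime q → ∀ m → n m ≤ n (suc m) → ∀ k .{{_ : NonZero k}} → suc k ≤ q →
      ℚ.∣ ℙ (randomComplex n (suc m)) (λ As → betti n m As ≟ 0ℤ) ℚ.- 1ℚ ∣ ℚ.≤ ℤ.+ 1 ℚ./ k
    ℙ-betti≡0 q-prime m n≤n k k<q = ∣p-1∣≤
      (begin
        1ℚ ℚ.- δ                                  ≡⟨ ℚ.*-identityˡ (1ℚ ℚ.- δ) ⟨
        1ℚ ℚ.* (1ℚ ℚ.- δ)                         ≡⟨ cong (ℚ._* (1ℚ ℚ.- δ)) (mass-randomComplex m) ⟨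
        mass (randomComplex n m) ℚ.* (1ℚ ℚ.- δ)
          ≤⟨ ℙ->>=-lower acyclic? {randomComplex n m} {extend m} (nonNegative-randomComplex m) lower ⟩
        ℙ (randomComplex n (suc m)) acyclic?      ∎)
      (begin
        ℙ (randomComplex n (suc m)) acyclic?
          ≤⟨ ℙ->>=-upper acyclic? {randomComplex n m} {extend m} (nonNegative-randomComplex m) upper ⟩
        mass (randomComplex n m) ℚ.* 1ℚ           ≡⟨ ℚ.*-identityʳ _ ⟩
        mass (randomComplex n m)                  ≡⟨ mass-randomComplex m ⟩
        1ℚ                                        ∎)
      where
      open ℚ.≤-Reasoning
      δ = ℤ.+ 1 ℚ./ k
      acyclic? : Decidable (λ (As : Matrices n (suc m)) → betti n m As ≡ 0ℤ)
      acyclic? As = betti n m As ≟ 0ℤ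
      module _ (As : Matrices n m) where
        Aₘ : Matrix (target n m) (n m)
        Aₘ = lastMatrix n As
        instance
          next-nonEmpty : NonZero (length (next m As))
          next-nonEmpty = annihilated-nonEmpty Aₘ (n (suc m))
        acyclic⊎deficient : ∀ {X} → X ∈ next m As → betti n m (As , X) ≡ 0ℤ ⊎ Deficient Aₘ X
        acyclic⊎deficient {X} X∈ with deficient? Aₘ X
        ... | yes deficient  = inj₂ deficient
        ... | no  ¬deficient = inj₁ (trans
          (cong (nul Aₘ ⊖_) (sym (nul≡rank Aₘ X (∈-annihilated⁻ Aₘ X∈) ¬deficient)))
          (ℤ.n⊖n≡0 (nul Aₘ)))
        lower : 1ℚ ℚ.- δ ℚ.≤ ℙ (extend m As) acyclic?
        lower = begin
          1ℚ ℚ.- δ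
            ≤⟨ ℙ-uniform-lower (acyclic? ∘ (As ,_)) (deficient? Aₘ) (next m As) k acyclic⊎deficient few ⟩
          ℙ (uniform (next m As)) (acyclic? ∘ (As ,_))
            ≡⟨ ℙ-mapDist acyclic? (As ,_) (uniform (next m As)) ⟨
          ℙ (extend m As) acyclic? ∎
          where
          few : count (deficient? Aₘ) (next m As) ℕ.* k ≤ length (next m As)
          -- `suc k ≤ q` gives k ≤ q - 1, the factor in `few-deficient`.
          few = ℕ.≤-trans (ℕ.*-monoʳ-≤ (count (deficient? Aₘ) (next m As)) (ℕ.pred-mono-≤ k<q))
                          (few-deficient q-prime Aₘ n≤n)
        upper : ℙ (extend m As) acyclic? ℚ.≤ 1ℚ
        upper = subst (ℚ._≤ 1ℚ) (sym (ℙ-mapDist acyclic? (As ,_) (uniform (next m As))))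
                      (ℙ-uniform≤1 (acyclic? ∘ (As ,_)) (next m As))

corollary4p3 : (n : ℕ → ℕ) → (∀ m → n m ≤ n (suc m)) → (m : ℕ) →
    LimitOverPrimes (λ q → let open Over q in ℙ (randomComplex n (suc m)) (λ As → betti n m As ≟ 0ℤ)) 1ℚ
corollary4p3 n n-mono m ε 0<ε = suc k , λ q q-prime k<q →
  ℚ.≤-<-trans (ChainComplex.ℙ-betti≡0 q {{prime⇒nonZero q-prime}} n q-prime m (n-mono m) k k<q)
              (reciprocal-below ε 0<ε)
  -- k is the denominator of ε plus one, so 1 / k < ε; the threshold `suc k` ensures k ≤ q - 1.
  where k = suc (suc (ℚ.denominator-1 ε))
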